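{- Let $v,w\in S_n$ with $v\le w$ and $w$ $k$-Grassmannian, and let $f=f_{v,w}=w^{ -1}\tau_{k,n}v\in\mathbf{B}_{k,n}$ (so $f=x_wv$). Let $\mathbf{x_w}=(s_{i_1},\dots,s_{i_l})$ be a reduced word for $x_w$ and $\mathbf w$ a reduced word for $w$; the concatenation $\mathbf{x_w}\mathbf w$ is a reduced word for $\tau_{P_w}$. Then for any $r$, prepending all of $\mathbf{x_w}$, i.e. $(v_1,\dots,v_m)\mapsto(s_{i_1},\dots,s_{i_l},v_1,\dots,v_m)$, gives a bijection $$\mathcal{D}^r_{v,\mathbf w}\xrightarrow{\ \sim\ }\mathcal{A}^r_{x_wv,\,\mathbf{x_w}\mathbf w}=\mathcal{A}^r_{f,\,\boldsymbol{\tau_{P_w}}},$$ which restricts to a bijection $\operatorname{Deo}^{\max}_f\to\operatorname{Deo}^{\max}_{f,P_w}$. Moreover $(P_w)_U=w([k])=\overleftarrow{I_1}(f)$.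
   Context: Let $n\ge2$, $0\le k\le n$. $\tilde S_n$ is the group of bijections $f:\mathbb{Z}\to\mathbb{Z}$ with $f(i+n)=f(i)+n$, with products read left to right, $(fg)(a)=g(f(a))$. $\tilde S_n^{(k)}$ is the subset with $\frac1n\sum_{i=1}^n(f(i)-i)=k$, and $\mathbf{B}_{k,n}\subset\tilde S_n^{(k)}$ the subset with $i\le f(i)\le i+n$ for all $i$. $\overline f\in S_n$ is $f$ modulo $n$, $c(\overline f)$ its number of cycles. Length: $\ell(f)=\#\{(a,b):1\le a\le n,\ b\in\mathbb{Z},\ a<b,\ f(a)>f(b)\}$. $s_i$ ($0\le i\le n-1$) exchanges $i+mn$ and $i+1+mn$ for all $m$ and fixes all other integers. $\Lambda(i)=i+1$. $S_n=\langle s_1,\dots,s_{n-1}\rangle\subset\tilde S_n$ via periodic extension; $\tilde S_n^{(0)}=\langle s_0,\dots,s_{n-1}\rangle$; $\le$ is Bruhat order. A reduced word for $f\in\tilde S_n^{(k)}$ is a sequence $(s_{i_1},\dots,s_{i_m})$ with $s_{i_1}\cdots s_{i_m}=\Lambda^{ -k}f$, $m=\ell(f)$ (for $w\in S_n$, the usual notion). A subword of a word $\mathbf g=(s_{i_1},\dots,s_{i_m})$ is $\mathbf u=(u_1,\dots,u_m)$ with $u_j\in\{s_{i_j},e\}$; write $\mathbf u_{(j)}=u_1\cdots u_j$. It is distinguished if $\mathbf u_{(j)}\le\mathbf u_{(j-1)}s_{i_j}$ for all $j$. For $f\in\tilde S_n^{(k)}$ it is an $f$-subword if $\mathbf u_{(m)}=\Lambda^{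 -k}f$; for $v\in S_n$ and a word $\mathbf w$ in $s_1,\dots,s_{n-1}$, it is a $v$-subword if $\mathbf u_{(m)}=v$. $\mathcal{D}^r_{v,\mathbf w}$ is the set of distinguished $v$-subwords of $\mathbf w$ with exactly $r$ entries equal to $e$; $\mathcal{A}^r_{f,\mathbf g}$ is the set of distinguished $f$-subwords of $\mathbf g$ with exactly $r$ entries equal to $e$. $w\in S_n$ is $k$-Grassmannian if $w(1)<\dots<w(k)$ and $w(k+1)<\dots<w(n)$. $\tau_{k,n}\in\tilde S_n^{(k)}$: $\tau_{k,n}(i)=i+n$ for $1\le i\le k$, $\tau_{k,n}(i)=i$ for $k+1\le i\le n$. $x_w:=w^{ -1}\tau_{k,n}$. $P_w$ is the lattice path from $(0,0)$ to $(n-k,k)$ (unit right/up steps) whose set of up-step indices is $(P_w)_U=w([k])$; $\tau_{P_w}(i)=i+n$ if $i\bmod n\in(P_w)_U$ and $\tau_{P_w}(i)=i$ otherwise; $\boldsymbol{\tau_{P_w}}=\mathbf{x_w}\mathbf w$. Under the correspondence of crossings with selected letters and elbows with entries $e$, $f$-Deograms are the distinguished $v$-subwords of $\mathbf w$ and $(f,P_w)$-affine Deograms are the distinguished $f$-subwords of $\boldsymbol{\tau_{P_w}}$; so the maximal ones are $\operatorname{Deo}^{\max}_f=\mathcal{D}^{r_0}_{v,\mathbf w}$ and $\operatorname{Deo}^{\max}_{f,P_w}=\mathcal{A}^{r_0}_{f,\boldsymbol{\tau_{P_w}}}$ with $r_0=n-c(\overline f)$. Finally $\overleftarrow{I_1}(f)=\{a: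 a<1,\ f(a)\ge1\}\bmod n$ (residues in $[n]$). -}

module Defs where

open import Data.Bool.Base using (Bool; true; false; if_then_else_)
open import Data.Empty using (⊥-elim)
open import Data.Fin.Base as Fin using (Fin; toℕ; fromℕ<; inject₁)
import Data.Fin.Properties as Fin
open import Data.Fin.Permutation as Perm using (Permutation′; _⟨$⟩ʳ_; _⟨$⟩ˡ_; flip)
open import Data.Fin.Subset using (Subset; Side; inside; outside; ∁; ∣_∣)
open import Data.Integer.Base as ℤ using (ℤ; +_; 0ℤ; 1ℤ; _+_; _-_; -_; _*_; _<_; _≤_; _%ℕ_; _/ℕ_)
import Data.Integer.Properties as ℤ
open import Data.Integer.DivMod using (n%ℕd<d; a≡a%ℕn+[a/ℕn]*n)
open import Data.Integer.Divisibility.Signed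
  using (_∣_; _∣?_; ∣⇒∣ᵤ; ∣-refl; ∣m∣n⇒∣m+n; ∣m∣n⇒∣m-n)
open import Data.Integer.Tactic.RingSolver using (solve-∀)
import Data.List.Base as List
open import Data.Nat.Base as ℕ using (ℕ; zero; suc; NonZero; NonTrivial; nonTrivial⇒nonZero; nonTrivial⇒≢1)
import Data.Nat.Properties as ℕ
import Data.Nat.Divisibility as ℕ∣
open import Data.Product.Base using (Σ-syntax; ∃; ∃-syntax; ∃₂; _×_; _,_; proj₁; proj₂)
open import Data.Vec.Base as Vec using (Vec; []; _∷_; lookup; tabulate; replicate)
open import Data.Vec.Relation.Unary.All using (All)
open import Algebra.Properties.AbelianGroup ℤ.+-0-abelianGroup using () renaming (∙-cancelʳ to +-cancelʳ)
open import Algebra.Properties.CommutativeMonoid.Sum ℤ.+-0-commutativeMonoid using () renaming (sum to ∑)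
import Algebra.Properties.CommutativeMonoid.Sum ℕ.+-0-commutativeMonoid as ℕ∑
open import Function.Base using (_∘_)
open import Function.Bundles using (_↔_; mk↔ₛ′; mk⇔; Inverse; Bijection)
open import Function.Construct.Composition using (_↔-∘_)
open import Function.Construct.Identity using (↔-id)
open import Function.Construct.Symmetry using (↔-sym)
open import Level using (0ℓ)
open import Relation.Binary.Bundles using (Setoid)
open import Relation.Binary.Definitions using (tri<; tri≈; tri>)
import Relation.Binary.Construct.On as On
open import Relation.Binary.PropositionalEquality hiding ([_])
open import Relation.Nullary using (¬_; Dec; yes; no; does)
open import Relation.Nullary.Decidable using (does-⇔; _×-dec_)
open import Relation.Unary using (Pred)

private
  instance
    n≢0 : ∀ {n} .{{_ : NonTrivial n}} → NonZero n
    n≢0 {n} = nonTrivial⇒nonZero n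

------------------------------------------------------------------------
-- `Fin n` stands for [n] = {1, …, n}: i : Fin n is the
-- integer toℕ i + 1.

pos : ∀ {n} → Fin n → ℤ
pos i = + suc (toℕ i)

-- The element of [n] congruent to a modulo n.
residue : ∀ {n} .{{_ : NonTrivial n}} → ℤ → Fin n
residue {n} a = fromℕ< (n%ℕd<d (a - 1ℤ) n)

-- a ≡ pos (residue a) + block a * n
block : ∀ {n} .{{_ : NonTrivial n}} → ℤ → ℤ
block {n} a = (a - 1ℤ) /ℕ n

at : ∀ {n} → Fin n → ℤ → ℤ
at {n} i q = pos i + q * + n

module _ {n : ℕ} .{{_ : NonTrivial n}} where

  at-residue : ∀ a → at (residue {n} a) (block {n} a) ≡ a
  at-residue a = begin
    + suc (toℕ (residue {n} a)) + q * + n  ≡⟨ cong (λ r → + suc r + q * + n) (Fin.toℕ-fromℕ< (n%ℕd<d (a - 1ℤ) n)) ⟩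
    (1ℤ + + r) + q * + n                   ≡⟨ ℤ.+-assoc 1ℤ (+ r) (q * + n) ⟩
    1ℤ + (+ r + q * + n)                   ≡⟨ cong (λ z → 1ℤ + z) (a≡a%ℕn+[a/ℕn]*n (a - 1ℤ) n) ⟨
    1ℤ + (a - 1ℤ)                          ≡⟨ lem a ⟩
    a                                      ∎
    where
    open ≡-Reasoning
    q = block {n} a
    r = (a - 1ℤ) %ℕ n
    lem : ∀ a → 1ℤ + (a - 1ℤ) ≡ a
    lem = solve-∀

  at-mono-< : ∀ (i j : Fin n) {q r} → q < r → at i q < at j r
  at-mono-< i j {q} {r} q<r = begin-strict
    pos i + q * + n            ≤⟨ ℤ.+-monoˡ-≤ (q * + n) (ℤ.+≤+ (Fin.toℕ<n i)) ⟩
    + n + q * + n              ≡⟨ ℤ.suc-* q (+ n) ⟨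
    ℤ.suc q * + n              ≤⟨ ℤ.*-monoʳ-≤-nonNeg (+ n) (ℤ.i<j⇒suc[i]≤j q<r) ⟩
    r * + n                    ≡⟨ ℤ.+-identityˡ (r * + n) ⟨
    0ℤ + r * + n               <⟨ ℤ.+-monoˡ-< (r * + n) (ℤ.+<+ (ℕ.s≤s ℕ.z≤n)) ⟩
    pos j + r * + n            ∎
    where open ℤ.≤-Reasoning

  at-injective : ∀ {i j : Fin n} {q r} → at i q ≡ at j r → i ≡ j × q ≡ r
  at-injective {i} {j} {q} {r} eq with ℤ.<-cmp q r
  ... | tri< q<r _ _ = ⊥-elim (ℤ.<-irrefl eq (at-mono-< i j q<r))
  ... | tri> _ _ r<q = ⊥-elim (ℤ.<-irrefl (sym eq) (at-mono-< j i r<q))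
  ... | tri≈ _ refl _ =
    Fin.toℕ-injective (ℕ.suc-injective (ℤ.+-injective (+-cancelʳ (q * + n) (pos i) (pos j) eq))) , refl

  residue-at : ∀ (i : Fin n) q → residue (at i q) ≡ i
  residue-at i q = proj₁ (at-injective {_} {_} {block {n} (at i q)} {q} (at-residue (at i q)))

  block-at : ∀ (i : Fin n) q → block {n} (at i q) ≡ q
  block-at i q = proj₂ (at-injective {residue (at i q)} {i} (at-residue (at i q)))

  at-+n : ∀ (i : Fin n) q → at i (q + 1ℤ) ≡ at i q + + n
  at-+n i q = lem (pos i) q (+ n)
    where
    lem : ∀ p q n → p + (q + 1ℤ) * n ≡ p + q * n + n
    lem = solve-∀

  shift-at : ∀ a → at (residue {n} a) (block {n} a + 1ℤ) ≡ a + + n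
  shift-at a = trans (at-+n (residue a) (block {n} a)) (cong (_+ + n) (at-residue a))

  residue-+n : ∀ a → residue {n} (a + + n) ≡ residue a
  residue-+n a = trans (cong residue (sym (shift-at a))) (residue-at (residue a) (block {n} a + 1ℤ))

  block-+n : ∀ a → block {n} (a + + n) ≡ block {n} a + 1ℤ
  block-+n a = trans (cong (block {n}) (sym (shift-at a))) (block-at (residue a) _)

  -+-cancel : ∀ a → a - + n + + n ≡ a
  -+-cancel a = lem a (+ n)
    where
    lem : ∀ a n → a - n + n ≡ a
    lem = solve-∀

  residue--n : ∀ a → residue {n} (a - + n) ≡ residue a
  residue--n a = trans (sym (residue-+n (a - + n))) (cong residue (-+-cancel a))

------------------------------------------------------------------------
-- An element of S̃ₙ.
record AffPerm (n : ℕ) : Set where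
  field
    bijection : ℤ ↔ ℤ
    periodic  : ∀ a → Inverse.to bijection (a + + n) ≡ Inverse.to bijection a + + n

infixl 20 _⟨_⟩

_⟨_⟩ : ∀ {n} → AffPerm n → ℤ → ℤ
f ⟨ a ⟩ = Inverse.to (AffPerm.bijection f) a

infix 4 _≈_

_≈_ : ∀ {n} → AffPerm n → AffPerm n → Set
f ≈ g = ∀ a → f ⟨ a ⟩ ≡ g ⟨ a ⟩

ε : ∀ {n} → AffPerm n
ε = record { bijection = ↔-id ℤ ; periodic = λ _ → refl }

-- Products are read left to right: (f · g) ⟨ a ⟩ = g ⟨ f ⟨ a ⟩ ⟩.
infixl 9 _·_

_·_ : ∀ {n} → AffPerm n → AffPerm n → AffPerm n
f · g = record
  { bijection = AffPerm.bijection g ↔-∘ AffPerm.bijection f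
  ; periodic  = λ a → trans (cong (g ⟨_⟩) (AffPerm.periodic f a)) (AffPerm.periodic g (f ⟨ a ⟩))
  }

infix 30 _⁻¹

_⁻¹ : ∀ {n} → AffPerm n → AffPerm n
_⁻¹ {n} f = record
  { bijection = ↔-sym (AffPerm.bijection f)
  ; periodic  = λ a → begin
      from (a + + n)               ≡⟨ cong (λ x → from (x + + n)) (strictlyInverseˡ a) ⟨
      from (to (from a) + + n)     ≡⟨ cong from (AffPerm.periodic f (from a)) ⟨
      from (to (from a + + n))     ≡⟨ strictlyInverseʳ (from a + + n) ⟩
      from a + + n                 ∎
  }
  where
  open ≡-Reasoning
  open Inverse (AffPerm.bijection f)

-- Λ^ c is the c-th power of Λ, where Λ(a) = a + 1.
Λ^ : ∀ {n} → ℤ → AffPerm n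
Λ^ {n} c = record
  { bijection = mk↔ₛ′ (_+ c) (_- c) (λ a → lem₁ a c) (λ a → lem₂ a c)
  ; periodic  = λ a → lem₃ a (+ n) c
  }
  where
  lem₁ : ∀ a c → a - c + c ≡ a
  lem₁ = solve-∀
  lem₂ : ∀ a c → a + c - c ≡ a
  lem₂ = solve-∀
  lem₃ : ∀ a n c → a + n + c ≡ a + c + n
  lem₃ = solve-∀

-- Periodic extension S_n ⊂ S̃ₙ.
ext : ∀ {n} .{{_ : NonTrivial n}} → Permutation′ n → AffPerm n
ext {n} w = record
  { bijection = mk↔ₛ′ (act w) (act (flip w))
      (λ a → act-act w (flip w) (λ i → Perm.inverseʳ w) a)
      (λ a → act-act (flip w) w (λ i → Perm.inverseˡ w) a)
  ; periodic  = λ a → begin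
      act w (a + + n)
        ≡⟨ cong₂ (λ i q → at (w ⟨$⟩ʳ i) q) (residue-+n a) (block-+n a) ⟩
      at (w ⟨$⟩ʳ residue a) (block {n} a + 1ℤ)
        ≡⟨ at-+n (w ⟨$⟩ʳ residue a) (block {n} a) ⟩
      act w a + + n ∎
  }
  where
  open ≡-Reasoning
  act : Permutation′ n → ℤ → ℤ
  act π a = at (π ⟨$⟩ʳ residue a) (block {n} a)

  act-act : ∀ (π ρ : Permutation′ n) → (∀ i → π ⟨$⟩ʳ (ρ ⟨$⟩ʳ i) ≡ i) →
            ∀ a → act π (act ρ a) ≡ a
  act-act π ρ inv a = begin
    act π (act ρ a)
      ≡⟨ cong₂ (λ i q → at (π ⟨$⟩ʳ i) q) (residue-at (ρ ⟨$⟩ʳ residue a) (block {n} a))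
                                         (block-at (ρ ⟨$⟩ʳ residue a) (block {n} a)) ⟩
    at (π ⟨$⟩ʳ (ρ ⟨$⟩ʳ residue a)) (block {n} a)
      ≡⟨ cong (λ i → at i (block {n} a)) (inv (residue a)) ⟩
    at (residue {n} a) (block {n} a)
      ≡⟨ at-residue a ⟩
    a ∎

-- The affine permutation a ↦ a + n if the residue of a is in S, a ↦ a
-- otherwise.
translation : ∀ {n} .{{_ : NonTrivial n}} → (Fin n → Bool) → AffPerm n
translation {n} S = record
  { bijection = mk↔ₛ′ up down up-down down-up
  ; periodic  = periodic
  }
  where
  up down : ℤ → ℤ
  up a   = if S (residue a) then a + + n else a
  down a = if S (residue a) then a - + n else a

  up-down : ∀ a → up (down a) ≡ a
  up-down a with S (residue a) in eq
  ... | false rewrite eq = refl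
  ... | true rewrite residue--n {n} a | eq = -+-cancel {n} a

  down-up : ∀ a → down (up a) ≡ a
  down-up a with S (residue a) in eq
  ... | false rewrite eq = refl
  ... | true rewrite residue-+n {n} a | eq = lem a (+ n)
    where
    lem : ∀ a n → a + n - n ≡ a
    lem = solve-∀

  periodic : ∀ a → up (a + + n) ≡ up a + + n
  periodic a rewrite residue-+n {n} a with S (residue a)
  ... | true  = refl
  ... | false = refl

-- The generator sᵢ, 0 ≤ i ≤ n - 1, which exchanges i + mn and i + 1 + mn
-- for all m.  Here i : Fin n is toℕ i itself, not the element of [n].
module _ {n : ℕ} .{{_ : NonTrivial n}} where

  adjacent : Fin n → ℤ → ℤ
  adjacent i a with + n ∣? (a - + toℕ i) | + n ∣? (a - (+ toℕ i + 1ℤ))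
  ... | yes _ | _     = a + 1ℤ
  ... | no _  | yes _ = a - 1ℤ
  ... | no _  | no _  = a

  n∤1 : ¬ (+ n ∣ 1ℤ)
  n∤1 n∣1 = nonTrivial⇒≢1 (ℕ∣.∣1⇒≡1 (∣⇒∣ᵤ n∣1))

  adjacent-lower : ∀ i a → + n ∣ a - + toℕ i → adjacent i a ≡ a + 1ℤ
  adjacent-lower i a d with + n ∣? (a - + toℕ i) | + n ∣? (a - (+ toℕ i + 1ℤ))
  ... | yes _ | _ = refl
  ... | no ¬d | _ = ⊥-elim (¬d d)

  adjacent-upper : ∀ i a → + n ∣ a - (+ toℕ i + 1ℤ) → adjacent i a ≡ a - 1ℤ
  adjacent-upper i a d with + n ∣? (a - + toℕ i) | + n ∣? (a - (+ toℕ i + 1ℤ))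
  ... | yes c | _     = ⊥-elim (n∤1 (subst (+ n ∣_) (lem a (+ toℕ i)) (∣m∣n⇒∣m-n c d)))
    where
    lem : ∀ a i → (a - i) - (a - (i + 1ℤ)) ≡ 1ℤ
    lem = solve-∀
  ... | no _  | yes _ = refl
  ... | no _  | no ¬d = ⊥-elim (¬d d)

  adjacent-neither : ∀ i a → ¬ (+ n ∣ a - + toℕ i) → ¬ (+ n ∣ a - (+ toℕ i + 1ℤ)) → adjacent i a ≡ a
  adjacent-neither i a ¬c ¬d with + n ∣? (a - + toℕ i) | + n ∣? (a - (+ toℕ i + 1ℤ))
  ... | yes c | _     = ⊥-elim (¬c c)
  ... | no _  | yes d = ⊥-elim (¬d d)
  ... | no _  | no _  = refl

  adjacent-involutive : ∀ i a → adjacent i (adjacent i a) ≡ a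
  adjacent-involutive i a with + n ∣? (a - + toℕ i) | + n ∣? (a - (+ toℕ i + 1ℤ))
  ... | yes c | _     = trans (adjacent-upper i (a + 1ℤ) (subst (+ n ∣_) (lem₁ a (+ toℕ i)) c)) (lem₂ a)
    where
    lem₁ : ∀ a i → a - i ≡ (a + 1ℤ) - (i + 1ℤ)
    lem₁ = solve-∀
    lem₂ : ∀ a → a + 1ℤ - 1ℤ ≡ a
    lem₂ = solve-∀
  ... | no _  | yes d = trans (adjacent-lower i (a - 1ℤ) (subst (+ n ∣_) (lem₁ a (+ toℕ i)) d)) (lem₂ a)
    where
    lem₁ : ∀ a i → a - (i + 1ℤ) ≡ (a - 1ℤ) - i
    lem₁ = solve-∀
    lem₂ : ∀ a → a - 1ℤ + 1ℤ ≡ a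
    lem₂ = solve-∀
  ... | no ¬c | no ¬d = adjacent-neither i a ¬c ¬d

  ∣-+n : ∀ a c → + n ∣ a - c → + n ∣ (a + + n) - c
  ∣-+n a c d = subst (+ n ∣_) (lem a c (+ n)) (∣m∣n⇒∣m+n d ∣-refl)
    where
    lem : ∀ a c n → (a - c) + n ≡ (a + n) - c
    lem = solve-∀

  ∣-+n⁻ : ∀ a c → + n ∣ (a + + n) - c → + n ∣ a - c
  ∣-+n⁻ a c d = subst (+ n ∣_) (lem a c (+ n)) (∣m∣n⇒∣m-n d ∣-refl)
    where
    lem : ∀ a c n → ((a + n) - c) - n ≡ a - c
    lem = solve-∀

  adjacent-periodic : ∀ i a → adjacent i (a + + n) ≡ adjacent i a + + n
  adjacent-periodic i a with + n ∣? (a - + toℕ i) | + n ∣? (a - (+ toℕ i + 1ℤ))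
  ... | yes c | _     = trans (adjacent-lower i (a + + n) (∣-+n a _ c)) (lem a (+ n))
    where
    lem : ∀ a n → a + n + 1ℤ ≡ a + 1ℤ + n
    lem = solve-∀
  ... | no _  | yes d = trans (adjacent-upper i (a + + n) (∣-+n a _ d)) (lem a (+ n))
    where
    lem : ∀ a n → a + n - 1ℤ ≡ a - 1ℤ + n
    lem = solve-∀
  ... | no ¬c | no ¬d = adjacent-neither i (a + + n) (λ c → ¬c (∣-+n⁻ a _ c)) (λ d → ¬d (∣-+n⁻ a _ d))

  s : Fin n → AffPerm n
  s i = record
    { bijection = mk↔ₛ′ (adjacent i) (adjacent i) (adjacent-involutive i) (adjacent-involutive i)
    ; periodic  = adjacent-periodic i
    }

------------------------------------------------------------------------

-- (1/n) ∑ (f(i) - i) = k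
HasAverage : ∀ {n} → ℕ → AffPerm n → Set
HasAverage {n} k f = ∑ {n} (λ i → f ⟨ pos i ⟩ - pos i) ≡ + k * + n

𝐁 : ∀ {n} → ℕ → Pred (AffPerm n) 0ℓ
𝐁 {n} k f = HasAverage k f × (∀ a → a ≤ f ⟨ a ⟩ × f ⟨ a ⟩ ≤ a + + n)

------------------------------------------------------------------------

Inversion : ∀ {n} → AffPerm n → Set
Inversion {n} f = Σ[ (a , b) ∈ ℤ × ℤ ] (1ℤ ≤ a × a ≤ + n) × a < b × f ⟨ b ⟩ < f ⟨ a ⟩

-- ℓ(f) = m.  The inequalities on ℤ are proof-irrelevant, so the
-- elements of `Inversion f` are exactly the pairs (a , b).
HasLength : ∀ {n} → AffPerm n → ℕ → Set
HasLength f m = Inversion f ↔ Fin m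

Shorter : ∀ {n} → AffPerm n → AffPerm n → Set
Shorter f g = ∃₂ λ p q → HasLength f p × HasLength g q × p ℕ.< q

------------------------------------------------------------------------

-- t exchanges a + mn and b + mn for all m and fixes all other integers.
record Exchanges {n : ℕ} (a b : ℤ) (t : AffPerm n) : Set where
  field
    a<b   : a < b
    a≢b   : ¬ (+ n ∣ b - a)
    a↦b   : t ⟨ a ⟩ ≡ b
    b↦a   : t ⟨ b ⟩ ≡ a
    fixed : ∀ c → ¬ (+ n ∣ c - a) → ¬ (+ n ∣ c - b) → t ⟨ c ⟩ ≡ c

-- The reflections (conjugates of the generators) of the Coxeter groups
-- S̃ₙ⁽⁰⁾ and S_n.
Reflection Reflectionₛ : ∀ {n} → Pred (AffPerm n) 0ℓ
Reflection  t     = ∃₂ λ a b → Exchanges a b t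
Reflectionₛ {n} t = ∃₂ λ a b → 1ℤ ≤ a × b ≤ + n × Exchanges a b t

-- The order generated by u < u · t for t ∈ T with ℓ(u) < ℓ(u · t),
-- reflexive up to pointwise equality.
data Bruhat {n : ℕ} (T : Pred (AffPerm n) 0ℓ) (u w : AffPerm n) : Set where
  equal : u ≈ w → Bruhat T u w
  step  : ∀ t → T t → Shorter u (u · t) → Bruhat T (u · t) w → Bruhat T u w

infix 4 _≤ₛ_

_≤ₛ_ : ∀ {n} .{{_ : NonTrivial n}} → Permutation′ n → Permutation′ n → Set
v ≤ₛ w = Bruhat Reflectionₛ (ext v) (ext w)

------------------------------------------------------------------------

Word : ℕ → ℕ → Set
Word n m = Vec (Fin n) m

-- A subword (u₁, …, uₘ), uⱼ ∈ {s_{iⱼ}, e}, is the set of j with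
-- uⱼ = s_{iⱼ}.
Subword : ℕ → Set
Subword m = Subset m

-- The number of entries equal to e.
elbows : ∀ {m} → Subword m → ℕ
elbows 𝐮 = ∣ ∁ 𝐮 ∣

module _ {n : ℕ} .{{_ : NonTrivial n}} where

  entry : Fin n → Side → AffPerm n
  entry i inside  = s i
  entry i outside = ε

  -- 𝐮₍ⱼ₎ = u₁ ⋯ uⱼ
  partial : ∀ {m} → Word n m → Subword m → Fin (suc m) → AffPerm n
  partial _       _       Fin.zero    = ε
  partial (i ∷ 𝐠) (c ∷ 𝐮) (Fin.suc j) = entry i c · partial 𝐠 𝐮 j

  product : ∀ {m} → Word n m → Subword m → AffPerm n
  product {m} 𝐠 𝐮 = partial 𝐠 𝐮 (Fin.fromℕ m)

  wordProduct : ∀ {m} → Word n m → AffPerm n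
  wordProduct {m} 𝐠 = product 𝐠 (replicate m inside)

  -- 𝐮₍ⱼ₎ ≤ 𝐮₍ⱼ₋₁₎ s_{iⱼ} for all j
  Distinguished : Pred (AffPerm n) 0ℓ → ∀ {m} → Word n m → Subword m → Set
  Distinguished T {m} 𝐠 𝐮 =
    ∀ (j : Fin m) → Bruhat T (partial 𝐠 𝐮 (Fin.suc j)) (partial 𝐠 𝐮 (inject₁ j) · s (lookup 𝐠 j))

  -- For f ∈ S̃ₙ⁽ᵏ⁾.
  IsReducedWord : ∀ {m} → ℕ → AffPerm n → Word n m → Set
  IsReducedWord {m} k f 𝐠 = wordProduct 𝐠 ≈ Λ^ (- + k) · f × HasLength f m

  -- No s₀ occurs.
  IsWordₛ : ∀ {m} → Word n m → Set
  IsWordₛ = All (λ i → 1 ℕ.≤ toℕ i)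

  IsReducedWordₛ : ∀ {m} → Permutation′ n → Word n m → Set
  IsReducedWordₛ {m} w 𝐰 = IsWordₛ 𝐰 × wordProduct 𝐰 ≈ ext w × HasLength (ext w) m

  -- 𝒟ʳ_{v,𝐰}, for a word 𝐰 in s₁, …, sₙ₋₁
  𝒟 : ∀ {m} → ℕ → Permutation′ n → Word n m → Pred (Subword m) 0ℓ
  𝒟 r v 𝐰 𝐮 = Distinguished Reflectionₛ 𝐰 𝐮 × product 𝐰 𝐮 ≈ ext v × elbows 𝐮 ≡ r

  -- 𝒜ʳ_{f,𝐠}, for f ∈ S̃ₙ⁽ᵏ⁾
  𝒜 : ∀ {m} → ℕ → ℕ → AffPerm n → Word n m → Pred (Subword m) 0ℓ
  𝒜 r k f 𝐠 𝐮 = Distinguished Reflection 𝐠 𝐮 × product 𝐠 𝐮 ≈ Λ^ (- + k) · f × elbows 𝐮 ≡ r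

-- (v₁, …, vₘ) ↦ (s_{i₁}, …, s_{iₗ}, v₁, …, vₘ)
prepend : ∀ l {m} → Subword m → Subword (l ℕ.+ m)
prepend l 𝐮 = replicate l inside Vec.++ 𝐮

-- The elements of P, without regard to the proofs of membership.
⟦_⟧ : ∀ {A : Set} → Pred A 0ℓ → Setoid 0ℓ 0ℓ
⟦_⟧ {A} P = On.setoid {B = ∃ P} (setoid A) proj₁

RestrictsToBijection : ∀ {A B : Set} → (A → B) → Pred A 0ℓ → Pred B 0ℓ → Set
RestrictsToBijection φ P Q =
  Σ[ β ∈ Bijection ⟦ P ⟧ ⟦ Q ⟧ ] (∀ x → proj₁ (Bijection.to β x) ≡ φ (proj₁ x))

------------------------------------------------------------------------

IsGrassmannian : ∀ {n} → ℕ → Permutation′ n → Set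
IsGrassmannian k w =
  (∀ i j → i Fin.< j → toℕ j ℕ.< k → w ⟨$⟩ʳ i Fin.< w ⟨$⟩ʳ j) ×
  (∀ i j → i Fin.< j → k ℕ.≤ toℕ i → w ⟨$⟩ʳ i Fin.< w ⟨$⟩ʳ j)

module _ {n : ℕ} .{{_ : NonTrivial n}} where

  τ : ℕ → AffPerm n
  τ k = translation (λ i → does (toℕ i ℕ.<? k))

  x : ℕ → Permutation′ n → AffPerm n
  x k w = ext w ⁻¹ · τ k

  f[_,_] : Permutation′ n → Permutation′ n → ℕ → AffPerm n
  f[ v , w ] k = ext w ⁻¹ · τ k · ext v

------------------------------------------------------------------------

data Step : Set where
  right up : Step

-- End point of the path from (0,0) with the given steps.
endpoint : ∀ {m} → Vec Step m → ℕ × ℕ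
endpoint []          = 0 , 0
endpoint (right ∷ p) = let (a , b) = endpoint p in suc a , b
endpoint (up    ∷ p) = let (a , b) = endpoint p in a , suc b

record LatticePath (n k : ℕ) : Set where
  field
    steps : Vec Step n
    ends  : endpoint steps ≡ (n ℕ.∸ k , k)

open LatticePath public

isUp : Step → Bool
isUp right = false
isUp up    = true

upSteps : ∀ {n k} → LatticePath n k → Pred (Fin n) 0ℓ
upSteps P i = lookup (steps P) i ≡ up

-- w([k])
image : ∀ {n} → Permutation′ n → ℕ → Pred (Fin n) 0ℓ
image w k i = ∃[ j ] toℕ j ℕ.< k × w ⟨$⟩ʳ j ≡ i

image? : ∀ {n} (w : Permutation′ n) k i → Dec (image w k i)
image? w k i = Fin.any? (λ j → (toℕ j ℕ.<? k) ×-dec ((w ⟨$⟩ʳ j) Fin.≟ i))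

private
  stepAt : Bool → Step
  stepAt b = if b then up else right

  [_] : Bool → ℕ
  [ b ] = if b then 1 else 0

  endpoint-tabulate : ∀ {m} (b : Fin m → Bool) →
    endpoint (tabulate (stepAt ∘ b)) ≡ (m ℕ.∸ ℕ∑.sum ([_] ∘ b) , ℕ∑.sum ([_] ∘ b)) ×
    ℕ∑.sum ([_] ∘ b) ℕ.≤ m
  endpoint-tabulate {zero}  b = refl , ℕ.z≤n
  endpoint-tabulate {suc m} b with b Fin.zero | endpoint-tabulate (b ∘ Fin.suc)
  ... | true  | eq , le rewrite eq = refl , ℕ.s≤s le
  ... | false | eq , le rewrite eq = cong (_, ℕ∑.sum ([_] ∘ b ∘ Fin.suc)) (sym (ℕ.+-∸-assoc 1 le)) , ℕ.m≤n⇒m≤1+n le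

  count-below : ∀ n k → k ℕ.≤ n → ℕ∑.sum {n} (λ j → [ does (toℕ j ℕ.<? k) ]) ≡ k
  count-below zero    zero    _ = refl
  count-below (suc n) zero    _ = count-below n zero ℕ.z≤n
  count-below (suc n) (suc k) (ℕ.s≤s k≤n) =
    cong suc (count-below n k k≤n)

  does-image : ∀ {n} (w : Permutation′ n) k j → does (image? w k (w ⟨$⟩ʳ j)) ≡ does (toℕ j ℕ.<? k)
  does-image w k j = does-⇔ (mk⇔ below (λ j<k → j , j<k , refl)) (image? w k (w ⟨$⟩ʳ j)) (toℕ j ℕ.<? k)
    where
    below : image w k (w ⟨$⟩ʳ j) → toℕ j ℕ.< k
    below (j′ , j′<k , eq) = subst (λ h → toℕ h ℕ.< k)
      (trans (sym (Perm.inverseˡ w)) (trans (cong (w ⟨$⟩ˡ_) eq) (Perm.inverseˡ w))) j′<k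

  count-image : ∀ {n} (w : Permutation′ n) k → k ℕ.≤ n →
                ℕ∑.sum {n} (λ i → [ does (image? w k i) ]) ≡ k
  count-image {n} w k k≤n =
    trans (ℕ∑.sum-permute (λ i → [ does (image? w k i) ]) w)
      (trans (ℕ∑.sum-cong-≗ (λ j → cong [_] (does-image w k j))) (count-below n k k≤n))

-- P_w
path : ∀ {n} k → k ℕ.≤ n → Permutation′ n → LatticePath n k
path {n} k k≤n w = record
  { steps = tabulate (λ i → if does (image? w k i) then up else right)
  ; ends  = trans (proj₁ (endpoint-tabulate (λ i → does (image? w k i))))
                  (cong (λ c → n ℕ.∸ c , c) (count-image w k k≤n))
  }

τₚ : ∀ {n k} .{{_ : NonTrivial n}} → LatticePath n k → AffPerm n
τₚ P = translation (λ i → isUp (lookup (steps P) i))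

------------------------------------------------------------------------

module _ {n : ℕ} .{{_ : NonTrivial n}} where

  -- f modulo n
  bar : AffPerm n → Fin n → Fin n
  bar f i = residue (f ⟨ pos i ⟩)

  iterate : AffPerm n → ℕ → Fin n → Fin n
  iterate f zero    i = i
  iterate f (suc t) i = bar f (iterate f t i)

  -- i and j lie on the same cycle of f modulo n; fewer than n iterations
  -- suffice.
  SameCycle : AffPerm n → Fin n → Fin n → Set
  SameCycle f i j = ∃[ t ] iterate f (toℕ {n} t) i ≡ j

  sameCycle? : ∀ f i j → Dec (SameCycle f i j)
  sameCycle? f i j = Fin.any? (λ t → iterate f (toℕ {n} t) i Fin.≟ j)

  -- One representative is kept from each cycle.
  cycles : AffPerm n → ℕ
  cycles f = List.length (List.deduplicate (sameCycle? f) (List.allFin n))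

  -- {a : a < 1, f(a) ≥ 1} mod n
  I₁ : AffPerm n → Pred (Fin n) 0ℓ
  I₁ f i = ∃[ a ] a < 1ℤ × 1ℤ ≤ f ⟨ a ⟩ × residue a ≡ i

module _ {n : ℕ} .{{_ : NonTrivial n}} where

  Deoᵐᵃˣ : ∀ {m} → ℕ → (v w : Permutation′ n) → Word n m → Pred (Subword m) 0ℓ
  Deoᵐᵃˣ k v w 𝐰 = 𝒟 (n ℕ.∸ cycles (f[ v , w ] k)) v 𝐰

  affineDeoᵐᵃˣ : ∀ {m} → ℕ → AffPerm n → Word n m → Pred (Subword m) 0ℓ
  affineDeoᵐᵃˣ k f 𝐠 = 𝒜 (n ℕ.∸ cycles f) k f 𝐠

{-# OPTIONS --safe #-}
module Submission where

-- The element g = Λ⁻ᵏ x_w is the shortest one of its coset g S_n: for w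
-- Grassmannian, x_w⁻¹ is increasing on each block {1 + qn, …, n + qn}.
--
-- Surjectivity.  In any f-subword of 𝐱𝐰 the letters taken from 𝐰 multiply
-- to an element of S_n, so the letters taken from 𝐱 multiply to an element
-- of g S_n, which has length at least ℓ(g) = l.  As a product of c
-- generators has length at most c, all l letters of 𝐱 are taken.
--
-- Distinguishedness.  It remains to see that u ≤ u′ in S_n if and only if
-- g u ≤ g u′ in the affine order.  If t exchanges the values p < q, then
-- u < u t exactly when u⁻¹(p) < u⁻¹(q), and this condition is not affected
-- by g as long as p and q lie in the same block.  An affine Bruhat chain
-- from g u to g u′ never exchanges values of different blocks, because the
-- energy ∑_{1 ≤ i ≤ n} y⁻¹(i)² is constant on cosets y S_n and would
-- strictly increase.
--
-- Bounds on f.  The conditions "y ≤ c on (-∞, j]" and "y ≥ c on [j, ∞)" are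
-- inherited by smaller elements in Bruhat order, which gives v(j) ≤ w(j) for
-- j ≤ k and v(j) ≥ w(j) for j > k.

open import Defs
open import Data.Bool.Base using (Bool; true; false; if_then_else_)
open import Data.Empty using (⊥; ⊥-elim)
open import Data.Fin.Base as Fin using (Fin; toℕ; fromℕ<; combine; remQuot)
import Data.Fin.Properties as Fin
open import Data.Fin.Permutation as Perm using (Permutation′; _⟨$⟩ʳ_; _⟨$⟩ˡ_)
open import Data.Fin.Subset using (inside; outside; ∣_∣)
open import Data.Fin.Subset.Properties using (∣p∣≤n; ∣p∣≡n⇒p≡⊤; ∣⊤∣≡n)
open import Data.Integer.Base as ℤ using (ℤ; +_; -[1+_]; 0ℤ; 1ℤ; -_)
import Data.Integer.Properties as ℤ
open import Data.Integer.Divisibility.Signed using (_∣_; _∣?_; divides; ∣m∣n⇒∣m-n)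
open import Data.Integer.Tactic.RingSolver using (solve-∀)
open import Data.Nat.Base as ℕ using (ℕ; zero; suc; _≤_; _+_; NonTrivial)
import Data.Nat.Properties as ℕ
open import Data.Product.Base using (Σ; ∃-syntax; ∃₂; _×_; _,_; proj₁; proj₂)
open import Data.Sum.Base using (_⊎_; inj₁; inj₂)
open import Data.Sum.Function.Propositional using (_⊎-↔_)
open import Data.Vec.Base as Vec using ([]; _∷_; _++_; lookup; replicate)
open import Data.Vec.Functional using (removeAt)
open import Data.Vec.Properties using (lookup∘tabulate; ++-injectiveʳ)
open import Data.Vec.Relation.Unary.All using ([]; _∷_)
open import Algebra.Properties.AbelianGroup ℤ.+-0-abelianGroup using () renaming (∙-cancelˡ to +-cancelˡ)
open import Algebra.Properties.CommutativeMonoid.Sum ℤ.+-0-commutativeMonoid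
  using (sum; sum-remove; sum-permute; sum-cong-≗; sum-replicate-zero; ∑-distrib-+)
open import Function.Base using (_∘_)
open import Function.Bundles using (_↔_; mk↔ₛ′; Inverse; _↣_; mk↣; Injection)
open import Function.Construct.Composition using (_↔-∘_; _↣-∘_)
open import Function.Construct.Identity using (↔-id)
open import Function.Construct.Symmetry using (↔-sym)
open import Function.Properties.Inverse using (↔⇒↣)
open import Relation.Binary.Definitions using (tri<; tri≈; tri>)
open import Relation.Binary.PropositionalEquality hiding ([_])
open import Relation.Nullary using (¬_; Dec; yes; no; does)
open import Relation.Nullary.Decidable using (dec-true; dec-false)
open import Relation.Unary using (_≐_)

module _ {n : ℕ} (f : AffPerm n) where

  private
    module f = Inverse (AffPerm.bijection f)

  ⁻¹-inverseˡ : ∀ a → f ⁻¹ ⟨ f ⟨ a ⟩ ⟩ ≡ a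
  ⁻¹-inverseˡ = f.strictlyInverseʳ

  ⁻¹-inverseʳ : ∀ a → f ⟨ f ⁻¹ ⟨ a ⟩ ⟩ ≡ a
  ⁻¹-inverseʳ = f.strictlyInverseˡ

  ⟨⟩-injective : ∀ {a b} → f ⟨ a ⟩ ≡ f ⟨ b ⟩ → a ≡ b
  ⟨⟩-injective {a} {b} eq = begin
    a                    ≡⟨ ⁻¹-inverseˡ a ⟨
    f ⁻¹ ⟨ f ⟨ a ⟩ ⟩     ≡⟨ cong (f ⁻¹ ⟨_⟩) eq ⟩
    f ⁻¹ ⟨ f ⟨ b ⟩ ⟩     ≡⟨ ⁻¹-inverseˡ b ⟩
    b                    ∎
    where open ≡-Reasoning

  periodic-+ : ∀ a m → f ⟨ a ℤ.+ + m ℤ.* + n ⟩ ≡ f ⟨ a ⟩ ℤ.+ + m ℤ.* + n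
  periodic-+ a zero = begin
    f ⟨ a ℤ.+ 0ℤ ℤ.* + n ⟩    ≡⟨ cong (f ⟨_⟩) (lem a (+ n)) ⟩
    f ⟨ a ⟩                   ≡⟨ lem (f ⟨ a ⟩) (+ n) ⟨
    f ⟨ a ⟩ ℤ.+ 0ℤ ℤ.* + n    ∎
    where
    open ≡-Reasoning
    lem : ∀ a n → a ℤ.+ 0ℤ ℤ.* n ≡ a
    lem = solve-∀
  periodic-+ a (suc m) = begin
    f ⟨ a ℤ.+ + suc m ℤ.* + n ⟩           ≡⟨ cong (f ⟨_⟩) (lem a (+ m) (+ n)) ⟩
    f ⟨ a ℤ.+ + m ℤ.* + n ℤ.+ + n ⟩       ≡⟨ AffPerm.periodic f _ ⟩
    f ⟨ a ℤ.+ + m ℤ.* + n ⟩ ℤ.+ + n       ≡⟨ cong (ℤ._+ + n) (periodic-+ a m) ⟩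
    f ⟨ a ⟩ ℤ.+ + m ℤ.* + n ℤ.+ + n       ≡⟨ lem (f ⟨ a ⟩) (+ m) (+ n) ⟨
    f ⟨ a ⟩ ℤ.+ + suc m ℤ.* + n           ∎
    where
    open ≡-Reasoning
    lem : ∀ a m n → a ℤ.+ (1ℤ ℤ.+ m) ℤ.* n ≡ a ℤ.+ m ℤ.* n ℤ.+ n
    lem = solve-∀

  periodic-* : ∀ a c → f ⟨ a ℤ.+ c ℤ.* + n ⟩ ≡ f ⟨ a ⟩ ℤ.+ c ℤ.* + n
  periodic-* a (+ m)    = periodic-+ a m
  periodic-* a -[1+ m ] = begin
    f ⟨ b ⟩                                          ≡⟨ lem₁ (f ⟨ b ⟩) (+ suc m) (+ n) ⟩
    f ⟨ b ⟩ ℤ.+ + suc m ℤ.* + n ℤ.+ -[1+ m ] ℤ.* + n ≡⟨ cong (ℤ._+ -[1+ m ] ℤ.* + n) (periodic-+ b (suc m)) ⟨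
    f ⟨ b ℤ.+ + suc m ℤ.* + n ⟩ ℤ.+ -[1+ m ] ℤ.* + n ≡⟨ cong (λ a → f ⟨ a ⟩ ℤ.+ -[1+ m ] ℤ.* + n) (lem₂ a (+ suc m) (+ n)) ⟩
    f ⟨ a ⟩ ℤ.+ -[1+ m ] ℤ.* + n                     ∎
    where
    open ≡-Reasoning
    b = a ℤ.+ -[1+ m ] ℤ.* + n
    lem₁ : ∀ a c n → a ≡ a ℤ.+ c ℤ.* n ℤ.+ (- c) ℤ.* n
    lem₁ = solve-∀
    lem₂ : ∀ a c n → a ℤ.+ (- c) ℤ.* n ℤ.+ c ℤ.* n ≡ a
    lem₂ = solve-∀

module _ {n : ℕ} .{{_ : NonTrivial n}} where

  block-shift : ∀ a c → block {n} (a ℤ.+ c ℤ.* + n) ≡ block {n} a ℤ.+ c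
  block-shift a c = begin
    block {n} (a ℤ.+ c ℤ.* + n)                                    ≡⟨ cong (λ a → block {n} (a ℤ.+ c ℤ.* + n)) (at-residue {n} a) ⟨
    block {n} (at (residue {n} a) (block {n} a) ℤ.+ c ℤ.* + n)     ≡⟨ cong (block {n}) (lem (pos (residue {n} a)) (block {n} a) c (+ n)) ⟩
    block {n} (at (residue {n} a) (block {n} a ℤ.+ c))             ≡⟨ block-at {n} (residue {n} a) _ ⟩
    block {n} a ℤ.+ c                                              ∎
    where
    open ≡-Reasoning
    lem : ∀ p b c n → p ℤ.+ b ℤ.* n ℤ.+ c ℤ.* n ≡ p ℤ.+ (b ℤ.+ c) ℤ.* n
    lem = solve-∀

  pos≡at-0 : ∀ (i : Fin n) → pos i ≡ at i 0ℤ
  pos≡at-0 i = lem (pos i) (+ n)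
    where
    lem : ∀ p n → p ≡ p ℤ.+ 0ℤ ℤ.* n
    lem = solve-∀

  block-pos : ∀ (i : Fin n) → block {n} (pos i) ≡ 0ℤ
  block-pos i = trans (cong (block {n}) (pos≡at-0 i)) (block-at i 0ℤ)

  window⇒pos : ∀ {a} → 1ℤ ℤ.≤ a → a ℤ.≤ + n → ∃[ i ] pos {n} i ≡ a
  window⇒pos {+ suc m} _ (ℤ.+≤+ m<n) = fromℕ< m<n , cong (λ m → + suc m) (Fin.toℕ-fromℕ< m<n)
  window⇒pos {+ zero} (ℤ.+≤+ ()) _

  block-window : ∀ {a} → 1ℤ ℤ.≤ a → a ℤ.≤ + n → block {n} a ≡ 0ℤ
  block-window 1≤a a≤n with i , refl ← window⇒pos 1≤a a≤n = block-pos i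

  window-pos : ∀ (i : Fin n) → 1ℤ ℤ.≤ pos i × pos i ℤ.≤ + n
  window-pos i = ℤ.+≤+ (ℕ.s≤s ℕ.z≤n) , ℤ.+≤+ (Fin.toℕ<n i)

  block-mono-< : ∀ {a b} → block {n} a ℤ.< block {n} b → a ℤ.< b
  block-mono-< {a} {b} lt = subst₂ ℤ._<_ (at-residue {n} a) (at-residue {n} b) (at-mono-< (residue {n} a) (residue {n} b) lt)

  block-mono-≤ : ∀ {a b} → a ℤ.≤ b → block {n} a ℤ.≤ block {n} b
  block-mono-≤ a≤b = ℤ.≮⇒≥ λ lt → ℤ.<⇒≱ (block-mono-< lt) a≤b

-- Inversions are handled as pairs of integers modulo simultaneous
-- translation by n; `normalise` returns to 1 ≤ a ≤ n.

translate : ℕ → ℤ → ℤ × ℤ → ℤ × ℤ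
translate n c (a , b) = a ℤ.+ c ℤ.* + n , b ℤ.+ c ℤ.* + n

Inverted : ∀ {n} → AffPerm n → ℤ × ℤ → Set
Inverted f (a , b) = a ℤ.< b × f ⟨ b ⟩ ℤ.< f ⟨ a ⟩

Inverted-translate : ∀ {n} (f : AffPerm n) c {p} → Inverted f p → Inverted f (translate n c p)
Inverted-translate {n} f c {a , b} (a<b , fb<fa) =
  ℤ.+-monoˡ-< (c ℤ.* + n) a<b ,
  subst₂ ℤ._<_ (sym (periodic-* f b c)) (sym (periodic-* f a c)) (ℤ.+-monoˡ-< (c ℤ.* + n) fb<fa)

translate-inverse : ∀ n c p → translate n c (translate n (- c) p) ≡ p
translate-inverse n c (a , b) = cong₂ _,_ (lem a c (+ n)) (lem b c (+ n))
  where
  lem : ∀ a c n → a ℤ.+ (- c) ℤ.* n ℤ.+ c ℤ.* n ≡ a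
  lem = solve-∀

translate-+ : ∀ n c d p → translate n c (translate n d p) ≡ translate n (d ℤ.+ c) p
translate-+ n c d (a , b) = cong₂ _,_ (lem a c d (+ n)) (lem b c d (+ n))
  where
  lem : ∀ a c d n → a ℤ.+ d ℤ.* n ℤ.+ c ℤ.* n ≡ a ℤ.+ (d ℤ.+ c) ℤ.* n
  lem = solve-∀

Inversion-≡ : ∀ {n} (f : AffPerm n) {i j : Inversion f} → proj₁ i ≡ proj₁ j → i ≡ j
Inversion-≡ f {p , (l₁ , l₂) , l₃ , l₄} {.p , (m₁ , m₂) , m₃ , m₄} refl
  with refl ← ℤ.≤-irrelevant l₁ m₁ | refl ← ℤ.≤-irrelevant l₂ m₂
     | refl ← ℤ.<-irrelevant l₃ m₃ | refl ← ℤ.<-irrelevant l₄ m₄ = refl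

module _ {n : ℕ} .{{_ : NonTrivial n}} where

  normal : ℤ × ℤ → ℤ × ℤ
  normal p = translate n (- block {n} (proj₁ p)) p

  normal-window : ∀ p → proj₁ (normal p) ≡ pos (residue {n} (proj₁ p))
  normal-window (a , _) = trans (cong (ℤ._+ (- block {n} a) ℤ.* + n) (sym (at-residue {n} a))) (lem (pos (residue {n} a)) (block {n} a) (+ n))
    where
    lem : ∀ p b n → p ℤ.+ b ℤ.* n ℤ.+ (- b) ℤ.* n ≡ p
    lem = solve-∀

  normal-translate : ∀ c p → normal (translate n c p) ≡ normal p
  normal-translate c p@(a , b) = trans (translate-+ n _ c p) (cong (λ d → translate n d p) eq)
    where
    lem : ∀ b c → c ℤ.+ - (b ℤ.+ c) ≡ - b
    lem = solve-∀
    eq : c ℤ.+ - block {n} (a ℤ.+ c ℤ.* + n) ≡ - block {n} a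
    eq = trans (cong (λ b → c ℤ.+ - b) (block-shift a c)) (lem (block {n} a) c)

  normal-fixed : ∀ {p} → 1ℤ ℤ.≤ proj₁ p → proj₁ p ℤ.≤ + n → normal p ≡ p
  normal-fixed {a , b} 1≤a a≤n = trans (cong (λ c → translate n (- c) (a , b)) (block-window 1≤a a≤n)) (cong₂ _,_ (lem a (+ n)) (lem b (+ n)))
    where
    lem : ∀ a n → a ℤ.+ 0ℤ ℤ.* n ≡ a
    lem = solve-∀

  normal-≡ : ∀ {p q} → normal p ≡ normal q → ∃[ c ] p ≡ translate n c q
  normal-≡ {p} {q} eq = - bq ℤ.+ bp , (begin
    p                                     ≡⟨ translate-inverse n bp p ⟨
    translate n bp (normal p)             ≡⟨ cong (translate n bp) eq ⟩
    translate n bp (normal q)             ≡⟨ translate-+ n bp (- bq) q ⟩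
    translate n (- bq ℤ.+ bp) q           ∎)
    where
    open ≡-Reasoning
    bp = block {n} (proj₁ p)
    bq = block {n} (proj₁ q)

  normalise : ∀ (f : AffPerm n) p → Inverted f p → Inversion f
  normalise f p inv = normal p ,
    subst (λ a → 1ℤ ℤ.≤ a × a ℤ.≤ + n) (sym (normal-window p)) (window-pos (residue {n} (proj₁ p))) ,
    Inverted-translate f (- block {n} (proj₁ p)) inv

  inverted : ∀ (f : AffPerm n) (i : Inversion f) → Inverted f (proj₁ i)
  inverted f (_ , _ , inv) = inv

  Inversion-normal : ∀ (f : AffPerm n) (i : Inversion f) → normal (proj₁ i) ≡ proj₁ i
  Inversion-normal f (_ , (1≤a , a≤n) , _) = normal-fixed 1≤a a≤n

infix 4 _↪_

record _↪_ {n : ℕ} (f g : AffPerm n) : Set where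
  field
    map         : ℤ × ℤ → ℤ × ℤ
    equivariant : ∀ c p → map (translate n c p) ≡ translate n c (map p)
    preserves   : ∀ {p} → Inverted f p → Inverted g (map p)
    injective   : ∀ {p q} → Inverted f p → Inverted f q → map p ≡ map q → p ≡ q

module _ {n : ℕ} .{{_ : NonTrivial n}} where

  module _ {f g : AffPerm n} (E : f ↪ g) where

    open _↪_ E

    mapInversion : Inversion f → Inversion g
    mapInversion i = normalise g (map (proj₁ i)) (preserves (inverted f i))

    mapInversion-image : ∀ i {q} → proj₁ (mapInversion i) ≡ normal q →
                         ∃[ p ] Inverted f p × map p ≡ q × normal p ≡ proj₁ i
    mapInversion-image i {q} eq =
      let c , eq′ = normal-≡ {p = q} {q = map (proj₁ i)} (sym eq)
      in translate n c (proj₁ i) , Inverted-translate f c (inverted f i) ,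
         trans (equivariant c (proj₁ i)) (sym eq′) ,
         trans (normal-translate c (proj₁ i)) (Inversion-normal f i)

    mapInversion-injective : ∀ {i j} → mapInversion i ≡ mapInversion j → i ≡ j
    mapInversion-injective {i} {j} eq =
      let p , inv , eq′ , eq″ = mapInversion-image i {map (proj₁ j)} (cong proj₁ eq)
      in Inversion-≡ f (trans (sym eq″)
           (trans (cong normal (injective {p} inv (inverted f j) eq′)) (Inversion-normal f j)))

  along : ∀ {f g : AffPerm n} (h : AffPerm n) →
          (∀ {a b} → Inverted f (a , b) → Inverted g (h ⟨ a ⟩ , h ⟨ b ⟩)) → f ↪ g
  along h pres = record
    { map = λ (a , b) → h ⟨ a ⟩ , h ⟨ b ⟩
    ; equivariant = λ c (a , b) → cong₂ _,_ (periodic-* h a c) (periodic-* h b c)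
    ; preserves = pres
    ; injective = λ _ _ eq → cong₂ _,_ (⟨⟩-injective h (cong proj₁ eq)) (⟨⟩-injective h (cong proj₂ eq))
    }

  ↪-cong : ∀ {f g : AffPerm n} → f ≈ g → f ↪ g
  ↪-cong {f} {g} f≈g = along ε (λ {a} {b} (a<b , lt) → a<b , subst₂ ℤ._<_ (f≈g b) (f≈g a) lt)

  ↪-trans : ∀ {f g h : AffPerm n} → f ↪ g → g ↪ h → f ↪ h
  ↪-trans {f} {g} {h} E F = record
    { map = λ p → F.map (E.map p)
    ; equivariant = λ c p → trans (cong F.map (E.equivariant c p)) (F.equivariant c (E.map p))
    ; preserves = λ inv → F.preserves (E.preserves inv)
    ; injective = λ i j eq → E.injective i j (F.injective (E.preserves i) (E.preserves j) eq)
    }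
    where
    module E = _↪_ E
    module F = _↪_ F

-- Finiteness of the length

finite-Σ : ∀ N {P : Fin N → Set} → (∀ i → Dec (P i)) → (∀ {i} (p q : P i) → p ≡ q) →
           ∃[ m ] (Σ (Fin N) P ↔ Fin m)
finite-Σ zero    P? irr = 0 , mk↔ₛ′ (λ ()) (λ ()) (λ ()) (λ ())
finite-Σ (suc N) {P} P? irr with finite-Σ N (P? ∘ Fin.suc) irr | P? Fin.zero
... | m , bij | yes p₀ = suc m , mk↔ₛ′ to from to-from from-to
  where
  module bij = Inverse bij
  to : Σ (Fin (suc N)) P → Fin (suc m)
  to (Fin.zero  , _) = Fin.zero
  to (Fin.suc i , p) = Fin.suc (bij.to (i , p))
  from : Fin (suc m) → Σ (Fin (suc N)) P
  from Fin.zero    = Fin.zero , p₀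
  from (Fin.suc j) = let i , p = bij.from j in Fin.suc i , p
  to-from : ∀ j → to (from j) ≡ j
  to-from Fin.zero    = refl
  to-from (Fin.suc j) = cong Fin.suc (bij.strictlyInverseˡ j)
  from-to : ∀ x → from (to x) ≡ x
  from-to (Fin.zero  , p) = cong (Fin.zero ,_) (irr p₀ p)
  from-to (Fin.suc i , p) = cong (λ (i , p) → Fin.suc i , p) (bij.strictlyInverseʳ (i , p))
... | m , bij | no ¬p₀ = m , mk↔ₛ′ to from bij.strictlyInverseˡ from-to
  where
  module bij = Inverse bij
  to : Σ (Fin (suc N)) P → Fin m
  to (Fin.zero  , p) = ⊥-elim (¬p₀ p)
  to (Fin.suc i , p) = bij.to (i , p)
  from : Fin m → Σ (Fin (suc N)) P
  from j = let i , p = bij.from j in Fin.suc i , p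
  from-to : ∀ x → from (to x) ≡ x
  from-to (Fin.zero  , p) = ⊥-elim (¬p₀ p)
  from-to (Fin.suc i , p) = cong (λ (i , p) → Fin.suc i , p) (bij.strictlyInverseʳ (i , p))

bounded-Fin : ∀ {N} (g : Fin N → ℕ) → ∃[ M ] (∀ i → g i ≤ M)
bounded-Fin {zero}  g = 0 , λ ()
bounded-Fin {suc N} g with M , g≤M ← bounded-Fin (g ∘ Fin.suc) = g Fin.zero ℕ.⊔ M , λ where
  Fin.zero    → ℕ.m≤m⊔n (g Fin.zero) M
  (Fin.suc i) → ℕ.≤-trans (g≤M i) (ℕ.m≤n⊔m (g Fin.zero) M)

i≤+∣i∣ : ∀ i → i ℤ.≤ + ℤ.∣ i ∣
i≤+∣i∣ (+ _)    = ℤ.≤-refl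
i≤+∣i∣ -[1+ _ ] = ℤ.-≤+

-+∣i∣≤i : ∀ i → - + ℤ.∣ i ∣ ℤ.≤ i
-+∣i∣≤i i = subst₂ ℤ._≤_ (cong (λ m → - + m) (ℤ.∣-i∣≡∣i∣ i)) (ℤ.neg-involutive i) (ℤ.neg-mono-≤ (i≤+∣i∣ (- i)))

<⇒0<- : ∀ {a b} → a ℤ.< b → 0ℤ ℤ.< b ℤ.- a
<⇒0<- {a} {b} a<b = subst (ℤ._< b ℤ.- a) (ℤ.+-inverseʳ a) (ℤ.+-monoˡ-< (- a) a<b)

<-+-suc : ∀ a d → a ℤ.< a ℤ.+ + suc d
<-+-suc a d = subst (ℤ._< a ℤ.+ + suc d) (ℤ.+-identityʳ a) (ℤ.+-monoʳ-< a (ℤ.+<+ (ℕ.s≤s ℕ.z≤n)))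

<⇒≡+suc : ∀ {a b} → a ℤ.< b → ∃[ d ] b ≡ a ℤ.+ + suc d
<⇒≡+suc {a} {b} a<b with b ℤ.- a in eq | <⇒0<- a<b
... | + suc d | _ = d , trans (lem a b) (cong (λ z → a ℤ.+ z) eq)
  where
  lem : ∀ a b → b ≡ a ℤ.+ (b ℤ.- a)
  lem = solve-∀
... | + zero  | ℤ.+<+ ()

module _ {n : ℕ} .{{_ : NonTrivial n}} where

  displacement-periodic : ∀ (f : AffPerm n) a →
    let i = residue {n} a in f ⟨ a ⟩ ℤ.- a ≡ f ⟨ pos i ⟩ ℤ.- pos i
  displacement-periodic f a = begin
    f ⟨ a ⟩ ℤ.- a                      ≡⟨ cong (λ a → f ⟨ a ⟩ ℤ.- a) (at-residue {n} a) ⟨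
    f ⟨ at i q ⟩ ℤ.- at i q            ≡⟨ cong (ℤ._- at i q) (periodic-* f (pos i) q) ⟩
    f ⟨ pos i ⟩ ℤ.+ q ℤ.* + n ℤ.- at i q ≡⟨ lem (f ⟨ pos i ⟩) (pos i) (q ℤ.* + n) ⟩
    f ⟨ pos i ⟩ ℤ.- pos i              ∎
    where
    open ≡-Reasoning
    i = residue {n} a
    q = block {n} a
    lem : ∀ f p c → f ℤ.+ c ℤ.- (p ℤ.+ c) ≡ f ℤ.- p
    lem = solve-∀

  displacement-bounded : ∀ (f : AffPerm n) → ∃[ M ] (∀ a → - + M ℤ.≤ f ⟨ a ⟩ ℤ.- a × f ⟨ a ⟩ ℤ.- a ℤ.≤ + M)
  displacement-bounded f = M , λ a →
    subst (λ d → - + M ℤ.≤ d × d ℤ.≤ + M) (sym (displacement-periodic f a))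
      (ℤ.≤-trans (ℤ.neg-mono-≤ (ℤ.+≤+ (bound (residue {n} a)))) (-+∣i∣≤i (d (residue {n} a))) ,
       ℤ.≤-trans (i≤+∣i∣ (d (residue {n} a))) (ℤ.+≤+ (bound (residue {n} a))))
    where
    d : Fin n → ℤ
    d i = f ⟨ pos i ⟩ ℤ.- pos i
    M = proj₁ (bounded-Fin (λ i → ℤ.∣ d i ∣))
    bound = proj₂ (bounded-Fin (λ i → ℤ.∣ d i ∣))

  hasLength : ∀ (f : AffPerm n) → ∃[ m ] HasLength f m
  hasLength f = proj₁ finite , proj₂ finite ↔-∘ mk↔ₛ′ to from to-from from-to
    where
    M = proj₁ (displacement-bounded f)
    bound = proj₂ (displacement-bounded f)
    K = M + M

    P : Fin (n ℕ.* K) → Set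
    P e = let i , d = remQuot K e in f ⟨ pos i ℤ.+ + suc (toℕ d) ⟩ ℤ.< f ⟨ pos i ⟩

    finite = finite-Σ (n ℕ.* K) {P} (λ e → _ ℤ.<? _) ℤ.<-irrelevant

    gap : ∀ a d → f ⟨ a ℤ.+ + suc d ⟩ ℤ.< f ⟨ a ⟩ → d ℕ.< K
    gap a d lt = ℤ.drop‿+<+ (ℤ.≤-<-trans (ℤ.+≤+ (ℕ.n≤1+n d)) (begin-strict
      + suc d                          ≡⟨ lem₁ a (+ suc d) (f ⟨ b ⟩) ⟩
      f ⟨ b ⟩ ℤ.- a ℤ.- (f ⟨ b ⟩ ℤ.- b)  ≤⟨ ℤ.+-monoʳ-≤ (f ⟨ b ⟩ ℤ.- a) (ℤ.neg-mono-≤ (proj₁ (bound b))) ⟩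
      f ⟨ b ⟩ ℤ.- a ℤ.- (- + M)        <⟨ ℤ.+-monoˡ-< (- (- + M)) (ℤ.+-monoˡ-< (- a) lt) ⟩
      f ⟨ a ⟩ ℤ.- a ℤ.- (- + M)        ≤⟨ ℤ.+-monoˡ-≤ (- (- + M)) (proj₂ (bound a)) ⟩
      + M ℤ.- (- + M)                  ≡⟨ cong (λ z → + M ℤ.+ z) (ℤ.neg-involutive (+ M)) ⟩
      + K                              ∎))
      where
      open ℤ.≤-Reasoning
      b = a ℤ.+ + suc d
      lem₁ : ∀ a d f → d ≡ f ℤ.- a ℤ.- (f ℤ.- (a ℤ.+ d))
      lem₁ = solve-∀

    code : (inv : Inversion f) → ∃₂ λ (i : Fin n) (d : Fin K) → (pos i , pos i ℤ.+ + suc (toℕ d)) ≡ proj₁ inv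
    code ((a , b) , (1≤a , a≤n) , a<b , fb<fa)
      with i , refl ← window⇒pos {n} 1≤a a≤n | d , refl ← <⇒≡+suc a<b
      = i , fromℕ< (gap (pos i) d fb<fa) , cong (λ d → pos i , pos i ℤ.+ + suc d) (Fin.toℕ-fromℕ< _)

    to : Inversion f → Σ (Fin (n ℕ.* K)) P
    to inv@(_ , _ , _ , fb<fa) = let i , d , eq = code inv in
      combine i d ,
      subst (λ (i , d) → f ⟨ pos i ℤ.+ + suc (toℕ d) ⟩ ℤ.< f ⟨ pos i ⟩) (sym (Fin.remQuot-combine i d))
        (subst (λ (a , b) → f ⟨ b ⟩ ℤ.< f ⟨ a ⟩) (sym eq) fb<fa)

    from : Σ (Fin (n ℕ.* K)) P → Inversion f
    from (e , lt) = let i , d = remQuot K e in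
      (pos i , pos i ℤ.+ + suc (toℕ d)) , window-pos i , <-+-suc (pos i) (toℕ d) , lt

    from-to : ∀ inv → from (to inv) ≡ inv
    from-to inv = let i , d , eq = code inv in
      Inversion-≡ f (trans (cong (λ (i , d) → pos i , pos i ℤ.+ + suc (toℕ d)) (Fin.remQuot-combine i d)) eq)

    Σ-≡ : ∀ {x y : Σ (Fin (n ℕ.* K)) P} → proj₁ x ≡ proj₁ y → x ≡ y
    Σ-≡ {e , p} {.e , q} refl = cong (e ,_) (ℤ.<-irrelevant p q)

    to-from : ∀ x → to (from x) ≡ x
    to-from x@(e , _) =
      let i , d   = remQuot K e
          j , d′ , eq = code (from x)
          j≡i = Fin.toℕ-injective {i = j} {j = i} (ℕ.suc-injective (ℤ.+-injective (cong proj₁ eq)))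
          eq₂ = subst (λ k → pos k ℤ.+ + suc (toℕ d′) ≡ pos i ℤ.+ + suc (toℕ d)) j≡i (cong proj₂ eq)
          d′≡d = Fin.toℕ-injective {i = d′} {j = d} (ℕ.suc-injective (ℤ.+-injective (+-cancelˡ (pos i) _ _ eq₂)))
      in Σ-≡ (trans (cong₂ combine j≡i d′≡d) (Fin.combine-remQuot {n} K e))

+-cancelʳ-< : ∀ {a b} c → a ℤ.+ c ℤ.< b ℤ.+ c → a ℤ.< b
+-cancelʳ-< {a} {b} c lt = ℤ.≰⇒> λ b≤a → ℤ.<⇒≱ lt (ℤ.+-monoˡ-≤ c b≤a)

disjoint-≤ : ∀ {A B C : Set} {a b c} → A ↔ Fin a → B ↔ Fin b → C ↔ Fin c →
             (α : A ↣ C) (β : B ↣ C) → (∀ x y → Injection.to α x ≢ Injection.to β y) → a + b ≤ c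
disjoint-≤ {A} {B} {C} A↔ B↔ C↔ α β disjoint =
  Fin.injective⇒≤ (Injection.injective (↔⇒↣ C↔ ↣-∘ (mk↣ γ-injective ↣-∘ ↔⇒↣ (↔-sym (A↔ ⊎-↔ B↔) ↔-∘ Fin.+↔⊎))))
  where
  module α = Injection α
  module β = Injection β
  γ : A ⊎ B → C
  γ (inj₁ x) = α.to x
  γ (inj₂ y) = β.to y
  γ-injective : ∀ {x y} → γ x ≡ γ y → x ≡ y
  γ-injective {inj₁ _} {inj₁ _} eq = cong inj₁ (α.injective eq)
  γ-injective {inj₁ x} {inj₂ y} eq = ⊥-elim (disjoint x y eq)
  γ-injective {inj₂ y} {inj₁ x} eq = ⊥-elim (disjoint x y (sym eq))
  γ-injective {inj₂ _} {inj₂ _} eq = cong inj₂ (β.injective eq)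

Fin1-injection : ∀ {A : Set} → A → Fin 1 ↣ A
Fin1-injection x = mk↣ {to = λ _ → x} (λ {i} {j} _ → unique i j)
  where
  unique : ∀ (i j : Fin 1) → i ≡ j
  unique Fin.zero Fin.zero = refl

module _ {n : ℕ} .{{_ : NonTrivial n}} where

  inversions-↣ : ∀ {f g : AffPerm n} → f ↪ g → Inversion f ↣ Inversion g
  inversions-↣ E = mk↣ (λ {i} {j} → mapInversion-injective E {i} {j})

  HasLength-≤ : ∀ {f g : AffPerm n} {a b} → f ↪ g → HasLength f a → HasLength g b → a ≤ b
  HasLength-≤ {f} {g} E A B = Fin.injective⇒≤ (Injection.injective (↔⇒↣ B ↣-∘ (inversions-↣ {f} {g} E ↣-∘ ↔⇒↣ (↔-sym A))))

  ↪-antisym : ∀ {f g : AffPerm n} {a b} → f ↪ g → g ↪ f → HasLength f a → HasLength g b → a ≡ b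
  ↪-antisym {f} {g} E F A B = ℕ.≤-antisym (HasLength-≤ {f} {g} E A B) (HasLength-≤ {g} {f} F B A)

  ≈-sym : ∀ {f g : AffPerm n} → f ≈ g → g ≈ f
  ≈-sym f≈g a = sym (f≈g a)

  HasLength-unique : ∀ {f g : AffPerm n} {a b} → f ≈ g → HasLength f a → HasLength g b → a ≡ b
  HasLength-unique {f} {g} f≈g = ↪-antisym {f} {g} (↪-cong {f = f} {g = g} f≈g) (↪-cong {f = g} {g = f} (≈-sym {f} {g} f≈g))

  HasLength-cong : ∀ {f g : AffPerm n} {a} → f ≈ g → HasLength f a → HasLength g a
  HasLength-cong {f} {g} f≈g A =
    let b , B = hasLength g in subst (HasLength g) (sym (HasLength-unique {f} {g} f≈g A B)) B

  Shorter-cong : ∀ {f f′ g g′ : AffPerm n} → f ≈ f′ → g ≈ g′ → Shorter f g → Shorter f′ g′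
  Shorter-cong {f} {f′} {g} {g′} f≈ g≈ (p , q , A , B , p<q) =
    p , q , HasLength-cong {f} {f′} f≈ A , HasLength-cong {g} {g′} g≈ B , p<q

-- Multiplication by a reflection

module _ {n : ℕ} {p q : ℤ} {t : AffPerm n} (ex : Exchanges p q t) where

  open Exchanges ex renaming (a<b to p<q; a↦b to p↦q; b↦a to q↦p)

  exchange-cases : ∀ c → (∃[ m ] c ≡ p ℤ.+ m ℤ.* + n) ⊎ (∃[ m ] c ≡ q ℤ.+ m ℤ.* + n) ⊎ t ⟨ c ⟩ ≡ c
  exchange-cases c with + n ∣? (c ℤ.- p) | + n ∣? (c ℤ.- q)
  ... | yes (divides m eq) | _                  = inj₁ (m , trans (lem c p) (cong (λ d → p ℤ.+ d) eq))
    where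
    lem : ∀ c p → c ≡ p ℤ.+ (c ℤ.- p)
    lem = solve-∀
  ... | no _               | yes (divides m eq) = inj₂ (inj₁ (m , trans (lem c q) (cong (λ d → q ℤ.+ d) eq)))
    where
    lem : ∀ c q → c ≡ q ℤ.+ (c ℤ.- q)
    lem = solve-∀
  ... | no ¬c              | no ¬d              = inj₂ (inj₂ (fixed c ¬c ¬d))

  p+↦q+ : ∀ m → t ⟨ p ℤ.+ m ℤ.* + n ⟩ ≡ q ℤ.+ m ℤ.* + n
  p+↦q+ m = trans (periodic-* t p m) (cong (ℤ._+ m ℤ.* + n) p↦q)

  q+↦p+ : ∀ m → t ⟨ q ℤ.+ m ℤ.* + n ⟩ ≡ p ℤ.+ m ℤ.* + n
  q+↦p+ m = trans (periodic-* t q m) (cong (ℤ._+ m ℤ.* + n) q↦p)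

  exchange-involutive : ∀ c → t ⟨ t ⟨ c ⟩ ⟩ ≡ c
  exchange-involutive c with exchange-cases c
  ... | inj₁ (m , refl)        = trans (cong (t ⟨_⟩) (p+↦q+ m)) (q+↦p+ m)
  ... | inj₂ (inj₁ (m , refl)) = trans (cong (t ⟨_⟩) (q+↦p+ m)) (p+↦q+ m)
  ... | inj₂ (inj₂ eq)         = trans (cong (t ⟨_⟩) eq) eq

  exchange-⁻¹ : ∀ c → t ⁻¹ ⟨ c ⟩ ≡ t ⟨ c ⟩
  exchange-⁻¹ c = trans (cong (t ⁻¹ ⟨_⟩) (sym (exchange-involutive c))) (⁻¹-inverseˡ t (t ⟨ c ⟩))

  -- The same e serves for every g; with g = ε and g = u⁻¹ it measures how
  -- far t moves values and positions of u.
  exchange-displacement : ∀ c → ∃[ e ] (∀ (g : AffPerm n) → g ⟨ t ⟨ c ⟩ ⟩ ≡ g ⟨ c ⟩ ℤ.+ e ℤ.* (g ⟨ q ⟩ ℤ.- g ⟨ p ⟩))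
  exchange-displacement c with exchange-cases c
  ... | inj₁ (m , refl) = 1ℤ , λ g → begin
    g ⟨ t ⟨ p ℤ.+ m ℤ.* + n ⟩ ⟩   ≡⟨ cong (g ⟨_⟩) (p+↦q+ m) ⟩
    g ⟨ q ℤ.+ m ℤ.* + n ⟩         ≡⟨ periodic-* g q m ⟩
    g ⟨ q ⟩ ℤ.+ m ℤ.* + n         ≡⟨ lem (g ⟨ p ⟩) (g ⟨ q ⟩) (m ℤ.* + n) ⟩
    g ⟨ p ⟩ ℤ.+ m ℤ.* + n ℤ.+ 1ℤ ℤ.* (g ⟨ q ⟩ ℤ.- g ⟨ p ⟩) ≡⟨ cong (ℤ._+ _) (periodic-* g p m) ⟨
    g ⟨ p ℤ.+ m ℤ.* + n ⟩ ℤ.+ 1ℤ ℤ.* (g ⟨ q ⟩ ℤ.- g ⟨ p ⟩) ∎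
    where
    open ≡-Reasoning
    lem : ∀ p q m → q ℤ.+ m ≡ p ℤ.+ m ℤ.+ 1ℤ ℤ.* (q ℤ.- p)
    lem = solve-∀
  ... | inj₂ (inj₁ (m , refl)) = - 1ℤ , λ g → begin
    g ⟨ t ⟨ q ℤ.+ m ℤ.* + n ⟩ ⟩   ≡⟨ cong (g ⟨_⟩) (q+↦p+ m) ⟩
    g ⟨ p ℤ.+ m ℤ.* + n ⟩         ≡⟨ periodic-* g p m ⟩
    g ⟨ p ⟩ ℤ.+ m ℤ.* + n         ≡⟨ lem (g ⟨ p ⟩) (g ⟨ q ⟩) (m ℤ.* + n) ⟩
    g ⟨ q ⟩ ℤ.+ m ℤ.* + n ℤ.+ - 1ℤ ℤ.* (g ⟨ q ⟩ ℤ.- g ⟨ p ⟩) ≡⟨ cong (ℤ._+ _) (periodic-* g q m) ⟨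
    g ⟨ q ℤ.+ m ℤ.* + n ⟩ ℤ.+ - 1ℤ ℤ.* (g ⟨ q ⟩ ℤ.- g ⟨ p ⟩) ∎
    where
    open ≡-Reasoning
    lem : ∀ p q m → p ℤ.+ m ≡ q ℤ.+ m ℤ.+ (- 1ℤ) ℤ.* (q ℤ.- p)
    lem = solve-∀
  ... | inj₂ (inj₂ eq) = 0ℤ , λ g → trans (cong (g ⟨_⟩) eq) (lem (g ⟨ c ⟩) (g ⟨ q ⟩ ℤ.- g ⟨ p ⟩))
    where
    lem : ∀ c d → c ≡ c ℤ.+ 0ℤ ℤ.* d
    lem = solve-∀

module _ {n : ℕ} .{{_ : NonTrivial n}} {p q : ℤ} {t : AffPerm n} (ex : Exchanges p q t) where

  open Exchanges ex using () renaming (a<b to p<q; a↦b to p↦q; b↦a to q↦p)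

  module _ (u : AffPerm n) (P<Q : u ⁻¹ ⟨ p ⟩ ℤ.< u ⁻¹ ⟨ q ⟩) where

    private
      r : AffPerm n
      r = u · t · u ⁻¹

      r-involutive : ∀ a → r ⟨ r ⟨ a ⟩ ⟩ ≡ a
      r-involutive a = begin
        u ⁻¹ ⟨ t ⟨ u ⟨ u ⁻¹ ⟨ t ⟨ u ⟨ a ⟩ ⟩ ⟩ ⟩ ⟩ ⟩   ≡⟨ cong (λ c → u ⁻¹ ⟨ t ⟨ c ⟩ ⟩) (⁻¹-inverseʳ u _) ⟩
        u ⁻¹ ⟨ t ⟨ t ⟨ u ⟨ a ⟩ ⟩ ⟩ ⟩                   ≡⟨ cong (u ⁻¹ ⟨_⟩) (exchange-involutive ex (u ⟨ a ⟩)) ⟩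
        u ⁻¹ ⟨ u ⟨ a ⟩ ⟩                               ≡⟨ ⁻¹-inverseˡ u a ⟩
        a                                              ∎
        where open ≡-Reasoning

      ut-r : ∀ a → t ⟨ u ⟨ r ⟨ a ⟩ ⟩ ⟩ ≡ u ⟨ a ⟩
      ut-r a = trans (cong (t ⟨_⟩) (⁻¹-inverseʳ u _)) (exchange-involutive ex (u ⟨ a ⟩))

      -- By `exchange-displacement`, t moves value and position of an entry by
      -- the same multiple of q - p > 0 and Q - P > 0 respectively.  Comparing
      -- these multiples for a and b shows that the pair keeps either the order
      -- of its positions or the inversion of its values.
      unordered⇒inverted : ∀ {a b} → Inverted u (a , b) → ¬ r ⟨ a ⟩ ℤ.< r ⟨ b ⟩ → t ⟨ u ⟨ b ⟩ ⟩ ℤ.< t ⟨ u ⟨ a ⟩ ⟩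
      unordered⇒inverted {a} {b} (a<b , ub<ua) ra≮rb
        with eₐ , moveₐ ← exchange-displacement ex (u ⟨ a ⟩) | e_b , move_b ← exchange-displacement ex (u ⟨ b ⟩)
        with ℤ.≤-total e_b eₐ
      ... | inj₁ e_b≤eₐ = subst₂ ℤ._<_ (sym (move_b ε)) (sym (moveₐ ε))
        (ℤ.+-mono-<-≤ ub<ua (ℤ.*-monoʳ-≤-nonNeg (q ℤ.- p) {{ℤ.nonNegative (ℤ.<⇒≤ (<⇒0<- p<q))}} e_b≤eₐ))
      ... | inj₂ eₐ≤e_b = ⊥-elim (ra≮rb (subst₂ ℤ._<_ (position a eₐ (moveₐ (u ⁻¹))) (position b e_b (move_b (u ⁻¹)))
        (ℤ.+-mono-<-≤ a<b (ℤ.*-monoʳ-≤-nonNeg D {{ℤ.nonNegative (ℤ.<⇒≤ (<⇒0<- P<Q))}} eₐ≤e_b))))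
        where
        D = u ⁻¹ ⟨ q ⟩ ℤ.- u ⁻¹ ⟨ p ⟩
        position : ∀ a e → r ⟨ a ⟩ ≡ u ⁻¹ ⟨ u ⟨ a ⟩ ⟩ ℤ.+ e ℤ.* D → a ℤ.+ e ℤ.* D ≡ r ⟨ a ⟩
        position a e eq = trans (cong (ℤ._+ e ℤ.* D) (sym (⁻¹-inverseˡ u a))) (sym eq)

      r₂ : ℤ × ℤ → ℤ × ℤ
      r₂ (a , b) = r ⟨ a ⟩ , r ⟨ b ⟩

      reflect : ∀ p → Dec (r ⟨ proj₁ p ⟩ ℤ.< r ⟨ proj₂ p ⟩) → ℤ × ℤ
      reflect p (yes _) = r₂ p
      reflect p (no _)  = p

      reflection-ordered? : ∀ p → Dec (r ⟨ proj₁ p ⟩ ℤ.< r ⟨ proj₂ p ⟩)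
      reflection-ordered? (a , b) = r ⟨ a ⟩ ℤ.<? r ⟨ b ⟩

      r₂-translate : ∀ c p → r₂ (translate n c p) ≡ translate n c (r₂ p)
      r₂-translate c (a , b) = cong₂ _,_ (periodic-* r a c) (periodic-* r b c)

      reflect-translate : ∀ c p d d′ → reflect (translate n c p) d ≡ translate n c (reflect p d′)
      reflect-translate c p (yes _) (yes _) = r₂-translate c p
      reflect-translate c p (no _)  (no _)  = refl
      reflect-translate c p (yes lt) (no ¬lt) = ⊥-elim (¬lt (+-cancelʳ-< _ (subst (λ (a , b) → a ℤ.< b) (r₂-translate c p) lt)))
      reflect-translate c p (no ¬lt) (yes lt) = ⊥-elim (¬lt (subst (λ (a , b) → a ℤ.< b) (sym (r₂-translate c p)) (ℤ.+-monoˡ-< (c ℤ.* + n) lt)))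

      reflect-preserves : ∀ {p} d → Inverted u p → Inverted (u · t) (reflect p d)
      reflect-preserves {a , b} (yes lt) (_ , ub<ua) = lt , subst₂ ℤ._<_ (sym (ut-r b)) (sym (ut-r a)) ub<ua
      reflect-preserves (no ¬lt) inv = proj₁ inv , unordered⇒inverted inv ¬lt

      unordered-r₂ : ∀ {p} → Inverted u p → ¬ (r ⟨ proj₁ (r₂ p) ⟩ ℤ.< r ⟨ proj₂ (r₂ p) ⟩) → ⊥
      unordered-r₂ {a , b} (a<b , _) ¬lt = ¬lt (subst₂ ℤ._<_ (sym (r-involutive a)) (sym (r-involutive b)) a<b)

      reflect-injective : ∀ {p q} d d′ → Inverted u p → Inverted u q → reflect p d ≡ reflect q d′ → p ≡ q
      reflect-injective (yes _) (yes _) _ _ eq = cong₂ _,_ (⟨⟩-injective r (cong proj₁ eq)) (⟨⟩-injective r (cong proj₂ eq))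
      reflect-injective (no _)  (no _)  _ _ eq = eq
      reflect-injective (yes _) (no ¬lt) i _ refl = ⊥-elim (unordered-r₂ i ¬lt)
      reflect-injective (no ¬lt) (yes _) _ j refl = ⊥-elim (unordered-r₂ j ¬lt)

      embedding : u ↪ u · t
      embedding = record
        { map         = λ p → reflect p (reflection-ordered? p)
        ; equivariant = λ c p → reflect-translate c p (reflection-ordered? (translate n c p)) (reflection-ordered? p)
        ; preserves   = λ {p} → reflect-preserves (reflection-ordered? p)
        ; injective   = λ {p} {q} → reflect-injective (reflection-ordered? p) (reflection-ordered? q)
        }

      P = u ⁻¹ ⟨ p ⟩
      Q = u ⁻¹ ⟨ q ⟩

      r-P : r ⟨ P ⟩ ≡ Q
      r-P = cong (u ⁻¹ ⟨_⟩) (trans (cong (t ⟨_⟩) (⁻¹-inverseʳ u p)) p↦q)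

      r-Q : r ⟨ Q ⟩ ≡ P
      r-Q = cong (u ⁻¹ ⟨_⟩) (trans (cong (t ⟨_⟩) (⁻¹-inverseʳ u q)) q↦p)

      missed : ∀ {p} d → Inverted u p → reflect p d ≢ (P , Q)
      missed {a , b} (yes _) (a<b , _) eq = ℤ.<-asym P<Q (subst₂ ℤ._<_
        (trans (sym (r-involutive a)) (trans (cong (r ⟨_⟩) (cong proj₁ eq)) r-P))
        (trans (sym (r-involutive b)) (trans (cong (r ⟨_⟩) (cong proj₂ eq)) r-Q)) a<b)
      missed (no _) (_ , ub<ua) refl = ℤ.<-asym p<q (subst₂ ℤ._<_ (⁻¹-inverseʳ u q) (⁻¹-inverseʳ u p) ub<ua)

      PQ-inverted : Inverted (u · t) (P , Q)
      PQ-inverted = P<Q , subst₂ ℤ._<_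
        (sym (trans (cong (t ⟨_⟩) (⁻¹-inverseʳ u q)) q↦p)) (sym (trans (cong (t ⟨_⟩) (⁻¹-inverseʳ u p)) p↦q)) p<q

    ordered⇒Shorter : Shorter u (u · t)
    ordered⇒Shorter =
      let a , A = hasLength u
          b , B = hasLength (u · t)
      in a , b , A , B , disjoint-≤ (Fin↔ 1) A B
           (Fin1-injection (normalise (u · t) (P , Q) PQ-inverted)) (inversions-↣ {f = u} {g = u · t} embedding)
           (λ _ i eq → let p , inv , eq′ , _ = mapInversion-image embedding i {P , Q} (sym (cong proj₁ eq))
                       in missed (reflection-ordered? p) inv eq′)
      where
      Fin↔ : ∀ m → Fin m ↔ Fin m
      Fin↔ m = ↔-id (Fin m)

  Shorter⇒ordered : ∀ (u : AffPerm n) → Shorter u (u · t) → u ⁻¹ ⟨ p ⟩ ℤ.< u ⁻¹ ⟨ q ⟩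
  Shorter⇒ordered u (a , b , A , B , a<b) with ℤ.<-cmp (u ⁻¹ ⟨ p ⟩) (u ⁻¹ ⟨ q ⟩)
  ... | tri< lt _ _ = lt
  ... | tri≈ _ eq _ = ⊥-elim (ℤ.<-irrefl (⟨⟩-injective (u ⁻¹) eq) p<q)
  ... | tri> _ _ gt =
    let b′ , a′ , B′ , A′ , b′<a′ = ordered⇒Shorter (u · t) (subst₂ ℤ._<_
          (sym (cong (u ⁻¹ ⟨_⟩) (trans (exchange-⁻¹ ex p) p↦q))) (sym (cong (u ⁻¹ ⟨_⟩) (trans (exchange-⁻¹ ex q) q↦p))) gt)
        a≡a′ = HasLength-unique {f = u} {g = u · t · t} (λ c → sym (exchange-involutive ex (u ⟨ c ⟩))) A A′
        b≡b′ = HasLength-unique {f = u · t} {g = u · t} (λ _ → refl) B B′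
    in ⊥-elim (ℕ.<-asym a<b (subst₂ ℕ._<_ (sym b≡b′) (sym a≡a′) b′<a′))

module _ {n : ℕ} .{{_ : NonTrivial n}} where

  Bruhat-cong : ∀ {T} {u u′ w w′ : AffPerm n} → u ≈ u′ → w ≈ w′ → Bruhat T u w → Bruhat T u′ w′
  Bruhat-cong u≈ w≈ (equal eq) = equal λ a → trans (sym (u≈ a)) (trans (eq a) (w≈ a))
  Bruhat-cong {u = u} {u′} u≈ w≈ (step t t∈T sh rest) =
    step t t∈T (Shorter-cong {f = u} {u′} {u · t} {u′ · t} u≈ (λ a → cong (t ⟨_⟩) (u≈ a)) sh)
      (Bruhat-cong (λ a → cong (t ⟨_⟩) (u≈ a)) w≈ rest)

  Reflectionₛ⇒Reflection : ∀ {t : AffPerm n} → Reflectionₛ t → Reflection t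
  Reflectionₛ⇒Reflection (p , q , _ , _ , ex) = p , q , ex

  Bruhatₛ⇒Bruhat : ∀ {u w : AffPerm n} → Bruhat Reflectionₛ u w → Bruhat Reflection u w
  Bruhatₛ⇒Bruhat (equal eq)             = equal eq
  Bruhatₛ⇒Bruhat (step t t∈T sh rest) = step t (Reflectionₛ⇒Reflection t∈T) sh (Bruhatₛ⇒Bruhat rest)

  position-of : ∀ (u : AffPerm n) {a c} m → u ⟨ a ⟩ ≡ c ℤ.+ m ℤ.* + n → a ≡ u ⁻¹ ⟨ c ⟩ ℤ.+ m ℤ.* + n
  position-of u {a} {c} m eq = trans (sym (⁻¹-inverseˡ u a)) (trans (cong (u ⁻¹ ⟨_⟩) eq) (periodic-* (u ⁻¹) c m))

  value-at : ∀ (u : AffPerm n) c m → u ⟨ u ⁻¹ ⟨ c ⟩ ℤ.+ m ℤ.* + n ⟩ ≡ c ℤ.+ m ℤ.* + n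
  value-at u c m = trans (periodic-* u _ m) (cong (ℤ._+ m ℤ.* + n) (⁻¹-inverseʳ u c))

  Bruhat-upper : ∀ {u w : AffPerm n} {j c} → Bruhat Reflection u w →
                 (∀ a → a ℤ.≤ j → w ⟨ a ⟩ ℤ.≤ c) → (∀ a → a ℤ.≤ j → u ⟨ a ⟩ ℤ.≤ c)
  Bruhat-upper (equal eq) w≤c a a≤j = subst (ℤ._≤ _) (sym (eq a)) (w≤c a a≤j)
  Bruhat-upper {u} {w} {j} {c} (step t (p , q , ex) sh rest) w≤c a a≤j with exchange-cases ex (u ⟨ a ⟩)
  ... | inj₁ (m , eq) = begin
    u ⟨ a ⟩             ≡⟨ eq ⟩
    p ℤ.+ m ℤ.* + n     ≤⟨ ℤ.+-monoˡ-≤ (m ℤ.* + n) (ℤ.<⇒≤ (Exchanges.a<b ex)) ⟩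
    q ℤ.+ m ℤ.* + n     ≡⟨ trans (cong (t ⟨_⟩) eq) (p+↦q+ ex m) ⟨
    t ⟨ u ⟨ a ⟩ ⟩       ≤⟨ Bruhat-upper rest w≤c a a≤j ⟩
    c                   ∎
    where open ℤ.≤-Reasoning
  ... | inj₂ (inj₁ (m , eq)) = begin
    u ⟨ a ⟩             ≡⟨ eq ⟩
    q ℤ.+ m ℤ.* + n     ≡⟨ trans (cong (t ⟨_⟩) (value-at u p m)) (p+↦q+ ex m) ⟨
    t ⟨ u ⟨ b ⟩ ⟩       ≤⟨ Bruhat-upper rest w≤c b (ℤ.≤-trans (ℤ.<⇒≤ b<a) a≤j) ⟩
    c                   ∎
    where
    open ℤ.≤-Reasoning
    b = u ⁻¹ ⟨ p ⟩ ℤ.+ m ℤ.* + n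
    b<a : b ℤ.< a
    b<a = subst (b ℤ.<_) (sym (position-of u m eq)) (ℤ.+-monoˡ-< (m ℤ.* + n) (Shorter⇒ordered ex u sh))
  ... | inj₂ (inj₂ eq) = subst (ℤ._≤ c) eq (Bruhat-upper rest w≤c a a≤j)

  Bruhat-lower : ∀ {u w : AffPerm n} {j c} → Bruhat Reflection u w →
                 (∀ a → j ℤ.≤ a → c ℤ.≤ w ⟨ a ⟩) → (∀ a → j ℤ.≤ a → c ℤ.≤ u ⟨ a ⟩)
  Bruhat-lower (equal eq) c≤w a j≤a = subst (_ ℤ.≤_) (sym (eq a)) (c≤w a j≤a)
  Bruhat-lower {u} {w} {j} {c} (step t (p , q , ex) sh rest) c≤w a j≤a with exchange-cases ex (u ⟨ a ⟩)
  ... | inj₁ (m , eq) = begin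
    c                   ≤⟨ Bruhat-lower rest c≤w b (ℤ.≤-trans j≤a (ℤ.<⇒≤ a<b)) ⟩
    t ⟨ u ⟨ b ⟩ ⟩       ≡⟨ trans (cong (t ⟨_⟩) (value-at u q m)) (q+↦p+ ex m) ⟩
    p ℤ.+ m ℤ.* + n     ≡⟨ eq ⟨
    u ⟨ a ⟩             ∎
    where
    open ℤ.≤-Reasoning
    b = u ⁻¹ ⟨ q ⟩ ℤ.+ m ℤ.* + n
    a<b : a ℤ.< b
    a<b = subst (ℤ._< b) (sym (position-of u m eq)) (ℤ.+-monoˡ-< (m ℤ.* + n) (Shorter⇒ordered ex u sh))
  ... | inj₂ (inj₁ (m , eq)) = begin
    c                   ≤⟨ Bruhat-lower rest c≤w a j≤a ⟩
    t ⟨ u ⟨ a ⟩ ⟩       ≡⟨ trans (cong (t ⟨_⟩) eq) (q+↦p+ ex m) ⟩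
    p ℤ.+ m ℤ.* + n     ≤⟨ ℤ.+-monoˡ-≤ (m ℤ.* + n) (ℤ.<⇒≤ (Exchanges.a<b ex)) ⟩
    q ℤ.+ m ℤ.* + n     ≡⟨ eq ⟨
    u ⟨ a ⟩             ∎
    where open ℤ.≤-Reasoning
  ... | inj₂ (inj₂ eq) = subst (c ℤ.≤_) eq (Bruhat-lower rest c≤w a j≤a)

-- Bruhat order and cosets of S_n

sum-single : ∀ {n} (h : Fin n → ℤ) i → (∀ k → k ≢ i → h k ≡ 0ℤ) → sum h ≡ h i
sum-single {suc n} h i zero-off = begin
  sum h                        ≡⟨ sum-remove {i = i} h ⟩
  h i ℤ.+ sum (removeAt h i)   ≡⟨ cong (λ z → h i ℤ.+ z) (trans (sum-cong-≗ (λ k → zero-off _ (Fin.punchInᵢ≢i i k))) (sum-replicate-zero n)) ⟩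
  h i ℤ.+ 0ℤ                   ≡⟨ ℤ.+-identityʳ (h i) ⟩
  h i                          ∎
  where open ≡-Reasoning

sum-pair : ∀ {n} (h : Fin n → ℤ) {i j} → i ≢ j → (∀ k → k ≢ i → k ≢ j → h k ≡ 0ℤ) → sum h ≡ h i ℤ.+ h j
sum-pair {suc n} h {i} {j} i≢j zero-off = begin
  sum h                                   ≡⟨ sum-remove {i = i} h ⟩
  h i ℤ.+ sum (removeAt h i)              ≡⟨ cong (λ z → h i ℤ.+ z) (sum-single (removeAt h i) j′ off) ⟩
  h i ℤ.+ h (Fin.punchIn i j′)            ≡⟨ cong (λ k → h i ℤ.+ h k) (Fin.punchIn-punchOut i≢j) ⟩
  h i ℤ.+ h j                             ∎
  where
  open ≡-Reasoning
  j′ = Fin.punchOut i≢j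
  off : ∀ k → k ≢ j′ → removeAt h i k ≡ 0ℤ
  off k k≢j′ = zero-off (Fin.punchIn i k) (Fin.punchInᵢ≢i i k)
    (λ eq → k≢j′ (Fin.punchIn-injective i k j′ (trans eq (sym (Fin.punchIn-punchOut i≢j)))))

module _ {n : ℕ} .{{_ : NonTrivial n}} where

  -- Invariant under right multiplication by S_n, and increasing along the
  -- Bruhat order, strictly so at every step that leaves a coset of S_n.
  energy : AffPerm n → ℤ
  energy y = sum {n} (λ i → y ⁻¹ ⟨ pos i ⟩ ℤ.* y ⁻¹ ⟨ pos i ⟩)

  Exchanges-translate : ∀ {p q} {t : AffPerm n} c → Exchanges p q t → Exchanges (p ℤ.+ c ℤ.* + n) (q ℤ.+ c ℤ.* + n) t
  Exchanges-translate {p} {q} {t} c ex = record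
    { a<b   = ℤ.+-monoˡ-< (c ℤ.* + n) a<b
    ; a≢b   = λ d → a≢b (subst (+ n ∣_) (lem₁ p q (c ℤ.* + n)) d)
    ; a↦b   = p+↦q+ ex c
    ; b↦a   = q+↦p+ ex c
    ; fixed = λ z ¬d ¬e → fixed z (λ d → ¬d (lem₂ z p d)) (λ e → ¬e (lem₂ z q e))
    }
    where
    open Exchanges ex
    lem₁ : ∀ p q c → (q ℤ.+ c) ℤ.- (p ℤ.+ c) ≡ q ℤ.- p
    lem₁ = solve-∀
    lem₃ : ∀ z p c n → z ℤ.- p ℤ.- c ℤ.* n ≡ z ℤ.- (p ℤ.+ c ℤ.* n)
    lem₃ = solve-∀
    lem₂ : ∀ z p → + n ∣ z ℤ.- p → + n ∣ z ℤ.- (p ℤ.+ c ℤ.* + n)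
    lem₂ z p d = subst (+ n ∣_) (lem₃ z p c (+ n)) (∣m∣n⇒∣m-n d (divides c refl))

  Exchanges-window : ∀ {p q} {t : AffPerm n} → Exchanges p q t →
                     Exchanges (pos (residue {n} p)) (at (residue {n} q) (block {n} q ℤ.- block {n} p)) t
  Exchanges-window {p} {q} {t} ex = subst₂ (λ p q → Exchanges p q t)
    (trans (cong (ℤ._+ (- block {n} p) ℤ.* + n) (sym (at-residue {n} p))) (lem₁ (pos (residue {n} p)) (block {n} p) (+ n)))
    (trans (cong (ℤ._+ (- block {n} p) ℤ.* + n) (sym (at-residue {n} q))) (lem₂ (pos (residue {n} q)) (block {n} q) (block {n} p) (+ n)))
    (Exchanges-translate (- block {n} p) ex)
    where
    lem₁ : ∀ p b n → p ℤ.+ b ℤ.* n ℤ.+ (- b) ℤ.* n ≡ p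
    lem₁ = solve-∀
    lem₂ : ∀ q c b n → q ℤ.+ c ℤ.* n ℤ.+ (- b) ℤ.* n ≡ q ℤ.+ (c ℤ.- b) ℤ.* n
    lem₂ = solve-∀

  energy-step-window : ∀ {i j : Fin n} {Δ} {t : AffPerm n} (y : AffPerm n) → Exchanges (pos i) (at j Δ) t →
    energy (y · t) ≡ energy y ℤ.+ Δ ℤ.* (+ 2 ℤ.* + n ℤ.* (y ⁻¹ ⟨ at j Δ ⟩ ℤ.- y ⁻¹ ⟨ pos i ⟩))
  energy-step-window {i} {j} {Δ} {t} y ex = begin
    sum (λ k → z′ k ℤ.* z′ k)                     ≡⟨ sum-cong-≗ (λ k → lem₁ (z k ℤ.* z k) (z′ k ℤ.* z′ k)) ⟩
    sum (λ k → z k ℤ.* z k ℤ.+ h k)               ≡⟨ ∑-distrib-+ (λ k → z k ℤ.* z k) h ⟩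
    energy y ℤ.+ sum h                            ≡⟨ cong (λ s → energy y ℤ.+ s) (sum-pair h i≢j h-off) ⟩
    energy y ℤ.+ (h i ℤ.+ h j)                    ≡⟨ cong (λ s → energy y ℤ.+ s) total ⟩
    energy y ℤ.+ Δ ℤ.* (+ 2 ℤ.* + n ℤ.* (Q ℤ.- P)) ∎
    where
    open ≡-Reasoning
    z z′ h : Fin n → ℤ
    z  k = y ⁻¹ ⟨ pos k ⟩
    z′ k = (y · t) ⁻¹ ⟨ pos k ⟩
    h  k = z′ k ℤ.* z′ k ℤ.- z k ℤ.* z k
    P = y ⁻¹ ⟨ pos i ⟩
    Q = y ⁻¹ ⟨ at j Δ ⟩
    lem₁ : ∀ a b → b ≡ a ℤ.+ (b ℤ.- a)
    lem₁ = solve-∀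
    lem₂ : ∀ j Δ n → j ≡ j ℤ.+ Δ ℤ.* n ℤ.+ (- Δ) ℤ.* n
    lem₂ = solve-∀
    lem₃ : ∀ P Q Δ n → Q ℤ.* Q ℤ.- P ℤ.* P ℤ.+ ((P ℤ.+ (- Δ) ℤ.* n) ℤ.* (P ℤ.+ (- Δ) ℤ.* n) ℤ.- (Q ℤ.+ (- Δ) ℤ.* n) ℤ.* (Q ℤ.+ (- Δ) ℤ.* n))
                     ≡ Δ ℤ.* (+ 2 ℤ.* n ℤ.* (Q ℤ.- P))
    lem₃ = solve-∀
    lem₄ : ∀ d p → d ≡ (p ℤ.+ d) ℤ.- p
    lem₄ = solve-∀

    i≢j : i ≢ j
    i≢j refl = Exchanges.a≢b ex (divides Δ (sym (lem₄ (Δ ℤ.* + n) (pos i))))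

    z′-i : z′ i ≡ Q
    z′-i = cong (y ⁻¹ ⟨_⟩) (trans (exchange-⁻¹ ex (pos i)) (Exchanges.a↦b ex))

    z-j : z j ≡ Q ℤ.+ (- Δ) ℤ.* + n
    z-j = trans (cong (y ⁻¹ ⟨_⟩) (lem₂ (pos j) Δ (+ n))) (periodic-* (y ⁻¹) (at j Δ) (- Δ))

    z′-j : z′ j ≡ P ℤ.+ (- Δ) ℤ.* + n
    z′-j = trans (cong (y ⁻¹ ⟨_⟩) (trans (exchange-⁻¹ ex (pos j)) (trans (cong (t ⟨_⟩) (lem₂ (pos j) Δ (+ n))) (q+↦p+ ex (- Δ)))))
                 (periodic-* (y ⁻¹) (pos i) (- Δ))

    total : h i ℤ.+ h j ≡ Δ ℤ.* (+ 2 ℤ.* + n ℤ.* (Q ℤ.- P))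
    total = trans (cong₂ ℤ._+_
      (cong (λ x → x ℤ.* x ℤ.- P ℤ.* P) z′-i)
      (cong₂ (λ x x′ → x′ ℤ.* x′ ℤ.- x ℤ.* x) z-j z′-j)) (lem₃ P Q Δ (+ n))

    h-off : ∀ k → k ≢ i → k ≢ j → h k ≡ 0ℤ
    h-off k k≢i k≢j = trans (cong (λ x → x ℤ.* x ℤ.- z k ℤ.* z k) (cong (y ⁻¹ ⟨_⟩) (trans (exchange-⁻¹ ex (pos k)) fixed)))
                            (ℤ.+-inverseʳ (z k ℤ.* z k))
      where
      lem₅ : ∀ j Δ m n → j ℤ.+ Δ ℤ.* n ℤ.+ m ℤ.* n ≡ j ℤ.+ (Δ ℤ.+ m) ℤ.* n
      lem₅ = solve-∀
      fixed : t ⟨ pos k ⟩ ≡ pos k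
      fixed with exchange-cases ex (pos k)
      ... | inj₁ (m , eq)        = ⊥-elim (k≢i (proj₁ (at-injective {n} {k} {i} {0ℤ} {m} (trans (sym (pos≡at-0 k)) eq))))
      ... | inj₂ (inj₁ (m , eq)) = ⊥-elim (k≢j (proj₁ (at-injective {n} {k} {j} {0ℤ} {Δ ℤ.+ m} (trans (sym (pos≡at-0 k)) (trans eq (lem₅ (pos j) Δ m (+ n)))))))
      ... | inj₂ (inj₂ eq)       = eq

module _ {n : ℕ} .{{_ : NonTrivial n}} where

  module _ {p q : ℤ} {t : AffPerm n} (ex : Exchanges p q t) (y : AffPerm n) (sh : Shorter y (y · t)) where

    private
      Δ = block {n} q ℤ.- block {n} p
      factor = + 2 ℤ.* + n ℤ.* (y ⁻¹ ⟨ at (residue {n} q) Δ ⟩ ℤ.- y ⁻¹ ⟨ pos (residue {n} p) ⟩)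

      energy-step : energy (y · t) ≡ energy y ℤ.+ Δ ℤ.* factor
      energy-step = energy-step-window {i = residue {n} p} {residue {n} q} {Δ} {t} y (Exchanges-window ex)

      0<factor : 0ℤ ℤ.< factor
      0<factor = subst (ℤ._< factor) (ℤ.*-zeroʳ (+ 2 ℤ.* + n))
        (ℤ.*-monoˡ-<-pos (+ 2 ℤ.* + n) {{2n>0}} (<⇒0<- (Shorter⇒ordered (Exchanges-window ex) y sh)))
        where
        2n>0 : ℤ.Positive (+ 2 ℤ.* + n)
        2n>0 = ℤ.positive (subst (ℤ._< + 2 ℤ.* + n) refl (ℤ.*-monoˡ-<-pos (+ 2) {{_}} (ℤ.+<+ (ℕ.<-trans (ℕ.s≤s ℕ.z≤n) (ℕ.nonTrivial⇒n>1 n)))))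

      block-≤ : block {n} p ℤ.≤ block {n} q
      block-≤ = block-mono-≤ (ℤ.<⇒≤ (Exchanges.a<b ex))

    energy-mono-step : energy y ℤ.≤ energy (y · t)
    energy-mono-step = subst₂ ℤ._≤_ (ℤ.+-identityʳ (energy y)) (sym energy-step)
      (ℤ.+-monoʳ-≤ (energy y) (ℤ.*-monoʳ-≤-nonNeg factor {{ℤ.nonNegative (ℤ.<⇒≤ 0<factor)}} (ℤ.i≤j⇒0≤j-i block-≤)))

    energy-constant⇒block-≡ : energy (y · t) ℤ.≤ energy y → block {n} p ≡ block {n} q
    energy-constant⇒block-≡ le = ℤ.≤-antisym block-≤ (ℤ.≮⇒≥ λ lt → ℤ.<⇒≱
      (subst₂ ℤ._<_ (ℤ.+-identityʳ (energy y)) (sym energy-step)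
        (ℤ.+-monoʳ-< (energy y) (ℤ.*-monoʳ-<-pos factor {{ℤ.positive 0<factor}} (<⇒0<- lt)))) le)

  ⁻¹-cong : ∀ {y z : AffPerm n} → y ≈ z → y ⁻¹ ≈ z ⁻¹
  ⁻¹-cong {y} {z} eq a = begin
    y ⁻¹ ⟨ a ⟩                        ≡⟨ cong (y ⁻¹ ⟨_⟩) (trans (eq (z ⁻¹ ⟨ a ⟩)) (⁻¹-inverseʳ z a)) ⟨
    y ⁻¹ ⟨ y ⟨ z ⁻¹ ⟨ a ⟩ ⟩ ⟩         ≡⟨ ⁻¹-inverseˡ y (z ⁻¹ ⟨ a ⟩) ⟩
    z ⁻¹ ⟨ a ⟩                        ∎
    where open ≡-Reasoning

  energy-mono : ∀ {y z : AffPerm n} → Bruhat Reflection y z → energy y ℤ.≤ energy z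
  energy-mono {y} {z} (equal eq) = ℤ.≤-reflexive (sum-cong-≗ {n} (λ i → cong (λ x → x ℤ.* x) (⁻¹-cong {y} {z} eq (pos i))))
  energy-mono {y} (step t (p , q , ex) sh rest) = ℤ.≤-trans (energy-mono-step ex y sh) (energy-mono {y · t} rest)

  -- The extensions of elements of S_n are the affine permutations that
  -- preserve each block.
  BlockPreserving : AffPerm n → Set
  BlockPreserving u = ∀ a → block {n} (u ⟨ a ⟩) ≡ block {n} a

  -- g is the shortest element of its coset g S_n.
  BlockIncreasing : AffPerm n → Set
  BlockIncreasing g = ∀ {c d} → block {n} c ≡ block {n} d → c ℤ.< d → g ⁻¹ ⟨ c ⟩ ℤ.< g ⁻¹ ⟨ d ⟩

  BlockPreserving-ε : BlockPreserving ε
  BlockPreserving-ε _ = refl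

  BlockPreserving-· : ∀ {u w} → BlockPreserving u → BlockPreserving w → BlockPreserving (u · w)
  BlockPreserving-· {u} bu bw a = trans (bw (u ⟨ a ⟩)) (bu a)

  BlockPreserving-⁻¹ : ∀ {u} → BlockPreserving u → BlockPreserving (u ⁻¹)
  BlockPreserving-⁻¹ {u} bu a = trans (sym (bu (u ⁻¹ ⟨ a ⟩))) (cong (block {n}) (⁻¹-inverseʳ u a))

  BlockPreserving-ext : ∀ (w : Permutation′ n) → BlockPreserving (ext w)
  BlockPreserving-ext w a = block-at (w ⟨$⟩ʳ residue {n} a) (block {n} a)

  BlockPreserving-exchange : ∀ {p q} {t : AffPerm n} → block {n} p ≡ block {n} q → Exchanges p q t → BlockPreserving t
  BlockPreserving-exchange {p} {q} {t} bp≡bq ex c = case (exchange-cases ex c)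
    where
    moved : ∀ {p q m} → block {n} p ≡ block {n} q → t ⟨ p ℤ.+ m ℤ.* + n ⟩ ≡ q ℤ.+ m ℤ.* + n → c ≡ p ℤ.+ m ℤ.* + n →
            block {n} (t ⟨ c ⟩) ≡ block {n} c
    moved {p} {q} {m} bp≡bq eq refl = begin
      block {n} (t ⟨ p ℤ.+ m ℤ.* + n ⟩)  ≡⟨ cong (block {n}) eq ⟩
      block {n} (q ℤ.+ m ℤ.* + n)        ≡⟨ block-shift q m ⟩
      block {n} q ℤ.+ m                  ≡⟨ cong (ℤ._+ m) bp≡bq ⟨
      block {n} p ℤ.+ m                  ≡⟨ block-shift p m ⟨
      block {n} (p ℤ.+ m ℤ.* + n)        ∎
      where open ≡-Reasoning
    case : _ → block {n} (t ⟨ c ⟩) ≡ block {n} c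
    case (inj₁ (m , eq))        = moved {p} {q} {m} bp≡bq (p+↦q+ ex m) eq
    case (inj₂ (inj₁ (m , eq))) = moved {q} {p} {m} (sym bp≡bq) (q+↦p+ ex m) eq
    case (inj₂ (inj₂ eq))       = cong (block {n}) eq

  Reflectionₛ-block : ∀ {p q} {t : AffPerm n} → 1ℤ ℤ.≤ p → q ℤ.≤ + n → Exchanges p q t → block {n} p ≡ block {n} q
  Reflectionₛ-block 1≤p q≤n ex = trans (block-window 1≤p (ℤ.≤-trans (ℤ.<⇒≤ p<q) q≤n)) (sym (block-window (ℤ.≤-trans 1≤p (ℤ.<⇒≤ p<q)) q≤n))
    where p<q = Exchanges.a<b ex

  block-≡⇒Reflectionₛ : ∀ {p q} {t : AffPerm n} → block {n} p ≡ block {n} q → Exchanges p q t → Reflectionₛ t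
  block-≡⇒Reflectionₛ {p} {q} {t} bp≡bq ex = pos (residue {n} p) , pos (residue {n} q) ,
    proj₁ (window-pos (residue {n} p)) , proj₂ (window-pos (residue {n} q)) ,
    subst (λ q → Exchanges (pos (residue {n} p)) q t)
      (trans (cong (at (residue {n} q)) (ℤ.i≡j⇒i-j≡0 (sym bp≡bq))) (sym (pos≡at-0 (residue {n} q)))) (Exchanges-window ex)

  pos-residue : ∀ {u} → BlockPreserving u → ∀ i → pos (residue {n} (u ⟨ pos i ⟩)) ≡ u ⟨ pos i ⟩
  pos-residue {u} bu i = begin
    pos (residue {n} (u ⟨ pos i ⟩))                                 ≡⟨ pos≡at-0 (residue {n} (u ⟨ pos i ⟩)) ⟩
    at (residue {n} (u ⟨ pos i ⟩)) 0ℤ                               ≡⟨ cong (at _) (trans (bu (pos i)) (block-pos i)) ⟨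
    at (residue {n} (u ⟨ pos i ⟩)) (block {n} (u ⟨ pos i ⟩))        ≡⟨ at-residue {n} _ ⟩
    u ⟨ pos i ⟩                                                     ∎
    where open ≡-Reasoning

  residue-pos : ∀ (i : Fin n) → residue {n} (pos i) ≡ i
  residue-pos i = trans (cong (residue {n}) (pos≡at-0 i)) (residue-at i 0ℤ)

  restrict : ∀ u → BlockPreserving u → Permutation′ n
  restrict u bu = Perm.permutation (to u) (to (u ⁻¹))
    (inverse u (u ⁻¹) (BlockPreserving-⁻¹ {u} bu) (⁻¹-inverseʳ u)) (inverse (u ⁻¹) u bu (⁻¹-inverseˡ u))
    where
    to : AffPerm n → Fin n → Fin n
    to u i = residue {n} (u ⟨ pos i ⟩)
    inverse : ∀ u v → BlockPreserving v → (∀ a → u ⟨ v ⟨ a ⟩ ⟩ ≡ a) → ∀ i → to u (to v i) ≡ i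
    inverse u v bv inv i = trans (cong (residue {n}) (trans (cong (u ⟨_⟩) (pos-residue {v} bv i)) (inv (pos i)))) (residue-pos i)

  energy-coset : ∀ g u → BlockPreserving u → energy (g · u) ≡ energy g
  energy-coset g u bu = sym (begin
    energy g                                    ≡⟨ sum-permute (λ i → g ⁻¹ ⟨ pos i ⟩ ℤ.* g ⁻¹ ⟨ pos i ⟩) (restrict (u ⁻¹) bu⁻¹) ⟩
    sum {n} (λ i → let a = pos (residue {n} (u ⁻¹ ⟨ pos i ⟩)) in g ⁻¹ ⟨ a ⟩ ℤ.* g ⁻¹ ⟨ a ⟩) ≡⟨ sum-cong-≗ (λ i → cong (λ a → g ⁻¹ ⟨ a ⟩ ℤ.* g ⁻¹ ⟨ a ⟩) (pos-residue {u ⁻¹} bu⁻¹ i)) ⟩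
    energy (g · u)                                                                      ∎)
    where
    open ≡-Reasoning
    bu⁻¹ = BlockPreserving-⁻¹ {u} bu

  module _ (g : AffPerm n) (g↑ : BlockIncreasing g) where

    coset-reflects-< : ∀ {a b} → block {n} a ≡ block {n} b → g ⁻¹ ⟨ a ⟩ ℤ.< g ⁻¹ ⟨ b ⟩ → a ℤ.< b
    coset-reflects-< {a} {b} ba≡bb lt with ℤ.<-cmp a b
    ... | tri< a<b _ _ = a<b
    ... | tri≈ _ refl _ = ⊥-elim (ℤ.<-irrefl refl lt)
    ... | tri> _ _ b<a = ⊥-elim (ℤ.<-asym lt (g↑ (sym ba≡bb) b<a))

    Bruhat-coset⁺ : ∀ {u w} → BlockPreserving u → Bruhat Reflectionₛ u w → Bruhat Reflection (g · u) (g · w)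
    Bruhat-coset⁺ bu (equal eq) = equal (λ a → eq (g ⟨ a ⟩))
    Bruhat-coset⁺ {u} {w} bu (step t (p , q , 1≤p , q≤n , ex) sh rest) =
      step t (p , q , ex) (ordered⇒Shorter ex (g · u) (g↑ bu⁻¹-≡ (Shorter⇒ordered ex u sh)))
        (Bruhat-cong (λ _ → refl) (λ _ → refl)
          (Bruhat-coset⁺ {u · t} {w} (BlockPreserving-· {u} {t} bu (BlockPreserving-exchange bp≡bq ex)) rest))
      where
      bp≡bq = Reflectionₛ-block 1≤p q≤n ex
      bu⁻¹-≡ : block {n} (u ⁻¹ ⟨ p ⟩) ≡ block {n} (u ⁻¹ ⟨ q ⟩)
      bu⁻¹-≡ = trans (BlockPreserving-⁻¹ {u} bu p) (trans bp≡bq (sym (BlockPreserving-⁻¹ {u} bu q)))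

    Bruhat-coset⁻ : ∀ {y z u w} → BlockPreserving u → BlockPreserving w → y ≈ g · u → z ≈ g · w →
                    Bruhat Reflection y z → Bruhat Reflectionₛ u w
    Bruhat-coset⁻ {y} {z} {u} {w} bu bw y≈ z≈ (equal eq) = equal λ a → begin
      u ⟨ a ⟩                      ≡⟨ cong (u ⟨_⟩) (⁻¹-inverseʳ g a) ⟨
      u ⟨ g ⟨ g ⁻¹ ⟨ a ⟩ ⟩ ⟩       ≡⟨ trans (sym (y≈ _)) (trans (eq _) (z≈ _)) ⟩
      w ⟨ g ⟨ g ⁻¹ ⟨ a ⟩ ⟩ ⟩       ≡⟨ cong (w ⟨_⟩) (⁻¹-inverseʳ g a) ⟩
      w ⟨ a ⟩                      ∎
      where open ≡-Reasoning
    Bruhat-coset⁻ {y} {z} {u} {w} bu bw y≈ z≈ (step t (p , q , ex) sh rest) =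
      step t (block-≡⇒Reflectionₛ bp≡bq ex)
        (ordered⇒Shorter ex u (coset-reflects-< bu⁻¹-≡ (Shorter⇒ordered ex (g · u) sh′)))
        (Bruhat-coset⁻ {y · t} {z} {u · t} {w} (BlockPreserving-· {u} {t} bu (BlockPreserving-exchange bp≡bq ex)) bw
          (λ a → cong (t ⟨_⟩) (y≈ a)) z≈ rest)
      where
      sh′ : Shorter (g · u) (g · u · t)
      sh′ = Shorter-cong {f = y} {g · u} {y · t} {g · u · t} y≈ (λ a → cong (t ⟨_⟩) (y≈ a)) sh
      energy-≤ : energy (g · u · t) ℤ.≤ energy (g · u)
      energy-≤ = ℤ.≤-trans (energy-mono {g · u · t} {g · w} (Bruhat-cong {u = y · t} {u′ = g · u · t} {w = z} {w′ = g · w} (λ a → cong (t ⟨_⟩) (y≈ a)) z≈ rest))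
        (ℤ.≤-reflexive (trans (energy-coset g w bw) (sym (energy-coset g u bu))))
      bp≡bq : block {n} p ≡ block {n} q
      bp≡bq = energy-constant⇒block-≡ ex (g · u) sh′ energy-≤
      bu⁻¹-≡ : block {n} (u ⁻¹ ⟨ p ⟩) ≡ block {n} (u ⁻¹ ⟨ q ⟩)
      bu⁻¹-≡ = trans (BlockPreserving-⁻¹ {u} bu p) (trans bp≡bq (sym (BlockPreserving-⁻¹ {u} bu q)))

-- Words and subwords

module _ {n : ℕ} .{{_ : NonTrivial n}} where

  s-exchanges : ∀ (i : Fin n) → Exchanges (+ toℕ i) (+ toℕ i ℤ.+ 1ℤ) (s i)
  s-exchanges i = record
    { a<b   = <-+-suc (+ toℕ i) 0
    ; a≢b   = λ d → n∤1 (subst (+ n ∣_) (lem₁ (+ toℕ i)) d)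
    ; a↦b   = adjacent-lower i (+ toℕ i) (divides 0ℤ (ℤ.+-inverseʳ (+ toℕ i)))
    ; b↦a   = trans (adjacent-upper i (+ toℕ i ℤ.+ 1ℤ) (divides 0ℤ (ℤ.+-inverseʳ (+ toℕ i ℤ.+ 1ℤ)))) (lem₂ (+ toℕ i))
    ; fixed = adjacent-neither i
    }
    where
    lem₁ : ∀ i → i ℤ.+ 1ℤ ℤ.- i ≡ 1ℤ
    lem₁ = solve-∀
    lem₂ : ∀ i → i ℤ.+ 1ℤ ℤ.- 1ℤ ≡ i
    lem₂ = solve-∀

  BlockPreserving-s : ∀ (i : Fin n) → 1 ≤ toℕ i → BlockPreserving (s i)
  BlockPreserving-s i 1≤i = BlockPreserving-exchange
    (Reflectionₛ-block (ℤ.+≤+ 1≤i) (ℤ.+≤+ (subst (ℕ._≤ n) (ℕ.+-comm 1 (toℕ i)) (Fin.toℕ<n i))) (s-exchanges i)) (s-exchanges i)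

  module _ (i : Fin n) where

    private
      p = + toℕ i
      q = + toℕ i ℤ.+ 1ℤ
      ex = s-exchanges i

    s-upper : ∀ c → s i ⟨ c ⟩ ℤ.≤ c ℤ.+ 1ℤ
    s-upper c with exchange-cases ex c
    ... | inj₁ (m , refl)        = ℤ.≤-reflexive (trans (p+↦q+ ex m) (lem p (m ℤ.* + n)))
      where
      lem : ∀ p m → p ℤ.+ 1ℤ ℤ.+ m ≡ p ℤ.+ m ℤ.+ 1ℤ
      lem = solve-∀
    ... | inj₂ (inj₁ (m , refl)) = ℤ.≤-trans (ℤ.≤-reflexive (q+↦p+ ex m))
      (ℤ.≤-trans (ℤ.+-monoˡ-≤ (m ℤ.* + n) (ℤ.i≤i+j p 1ℤ)) (ℤ.i≤i+j (q ℤ.+ m ℤ.* + n) 1ℤ))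
    ... | inj₂ (inj₂ eq)         = subst (ℤ._≤ c ℤ.+ 1ℤ) (sym eq) (ℤ.i≤i+j c 1ℤ)

    s-reverses : ∀ {a b} → a ℤ.< b → ¬ s i ⟨ a ⟩ ℤ.< s i ⟨ b ⟩ → ∃[ m ] (a , b) ≡ translate n m (p , q)
    s-reverses {a} {b} a<b ¬lt = case (exchange-cases ex a)
      where
      sb<sa : s i ⟨ b ⟩ ℤ.< s i ⟨ a ⟩
      sb<sa = ℤ.≤∧≢⇒< (ℤ.≮⇒≥ ¬lt) (λ eq → ℤ.<-irrefl (sym (⟨⟩-injective (s i) eq)) a<b)
      sb≤a : s i ⟨ b ⟩ ℤ.≤ a
      sb≤a = ℤ.≮⇒≥ λ a<sb → ℤ.<⇒≱ sb<sa (ℤ.≤-trans (s-upper a) (subst (ℤ._≤ s i ⟨ b ⟩) (ℤ.+-comm 1ℤ a) (ℤ.i<j⇒suc[i]≤j a<sb)))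
      b≤a+1 : b ℤ.≤ a ℤ.+ 1ℤ
      b≤a+1 = begin
        b                            ≡⟨ exchange-involutive ex b ⟨
        s i ⟨ s i ⟨ b ⟩ ⟩            ≤⟨ s-upper (s i ⟨ b ⟩) ⟩
        s i ⟨ b ⟩ ℤ.+ 1ℤ             ≤⟨ ℤ.+-monoˡ-≤ 1ℤ sb≤a ⟩
        a ℤ.+ 1ℤ                     ∎
        where open ℤ.≤-Reasoning
      b≡a+1 : b ≡ a ℤ.+ 1ℤ
      b≡a+1 = ℤ.≤-antisym b≤a+1 (subst (ℤ._≤ b) (ℤ.+-comm 1ℤ a) (ℤ.i<j⇒suc[i]≤j a<b))
      a<sa : a ℤ.< s i ⟨ a ⟩
      a<sa = ℤ.≤-<-trans a≤sb sb<sa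
        where
        a≤sb : a ℤ.≤ s i ⟨ b ⟩
        a≤sb = ℤ.≮⇒≥ λ sb<a → ℤ.<⇒≱ a<b (begin
          b                       ≡⟨ exchange-involutive ex b ⟨
          s i ⟨ s i ⟨ b ⟩ ⟩       ≤⟨ s-upper (s i ⟨ b ⟩) ⟩
          s i ⟨ b ⟩ ℤ.+ 1ℤ        ≡⟨ ℤ.+-comm (s i ⟨ b ⟩) 1ℤ ⟩
          ℤ.suc (s i ⟨ b ⟩)       ≤⟨ ℤ.i<j⇒suc[i]≤j sb<a ⟩
          a                       ∎)
          where open ℤ.≤-Reasoning
      lem : ∀ p m → p ℤ.+ m ℤ.+ 1ℤ ≡ p ℤ.+ 1ℤ ℤ.+ m
      lem = solve-∀
      case : _ → ∃[ m ] (a , b) ≡ translate n m (p , q)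
      case (inj₁ (m , eq)) = m , cong₂ _,_ eq (trans b≡a+1 (trans (cong (ℤ._+ 1ℤ) eq) (lem p (m ℤ.* + n))))
      case (inj₂ (inj₁ (m , eq))) = ⊥-elim (ℤ.<-asym a<sa (subst₂ ℤ._<_
        (sym (trans (cong (s i ⟨_⟩) eq) (q+↦p+ ex m))) (sym eq) (ℤ.+-monoˡ-< (m ℤ.* + n) (Exchanges.a<b ex))))
      case (inj₂ (inj₂ eq)) = ⊥-elim (ℤ.<-irrefl (sym eq) a<sa)

    module _ (h : AffPerm n) where

      private
        shorten : (inv : Inversion (s i · h)) → let a , b = proj₁ inv in
                  Dec (s i ⟨ a ⟩ ℤ.< s i ⟨ b ⟩) → Fin 1 ⊎ Inversion h
        shorten ((a , b) , _ , _ , lt) (yes sa<sb) = inj₂ (normalise h (s i ⟨ a ⟩ , s i ⟨ b ⟩) (sa<sb , lt))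
        shorten _                      (no _)      = inj₁ Fin.zero

        unordered-normal : (inv : Inversion (s i · h)) → let a , b = proj₁ inv in
                           ¬ s i ⟨ a ⟩ ℤ.< s i ⟨ b ⟩ → proj₁ inv ≡ normal (p , q)
        unordered-normal inv@((a , b) , _ , a<b , _) ¬lt = let m , eq = s-reverses a<b ¬lt in
          trans (sym (Inversion-normal (s i · h) inv)) (trans (cong normal eq) (normal-translate m (p , q)))

        inj₂-proj : ∀ {j j′ : Inversion h} → _≡_ {A = Fin 1 ⊎ Inversion h} (inj₂ j) (inj₂ j′) → proj₁ j ≡ proj₁ j′
        inj₂-proj refl = refl

        normal-s-injective : ∀ (inv inv′ : Inversion (s i · h)) → let a , b = proj₁ inv ; a′ , b′ = proj₁ inv′ in
          normal (s i ⟨ a ⟩ , s i ⟨ b ⟩) ≡ normal (s i ⟨ a′ ⟩ , s i ⟨ b′ ⟩) → inv ≡ inv′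
        normal-s-injective inv inv′ eq =
          let a  , b  = proj₁ inv
              a′ , b′ = proj₁ inv′
              c , eq′ = normal-≡ {p = s i ⟨ a ⟩ , s i ⟨ b ⟩} {q = s i ⟨ a′ ⟩ , s i ⟨ b′ ⟩} eq
              inv≡ : proj₁ inv ≡ translate n c (proj₁ inv′)
              inv≡ = cong₂ _,_ (⟨⟩-injective (s i) (trans (cong proj₁ eq′) (sym (periodic-* (s i) a′ c))))
                               (⟨⟩-injective (s i) (trans (cong proj₂ eq′) (sym (periodic-* (s i) b′ c))))
          in Inversion-≡ (s i · h) (trans (sym (Inversion-normal (s i · h) inv))
               (trans (cong normal inv≡) (trans (normal-translate c (proj₁ inv′)) (Inversion-normal (s i · h) inv′))))

        shorten-injective : ∀ inv inv′ d d′ → shorten inv d ≡ shorten inv′ d′ → inv ≡ inv′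
        shorten-injective inv inv′ (yes _) (yes _) eq = normal-s-injective inv inv′ (inj₂-proj eq)
        shorten-injective inv inv′ (no ¬l) (no ¬l′) _ =
          Inversion-≡ (s i · h) (trans (unordered-normal inv ¬l) (sym (unordered-normal inv′ ¬l′)))

        ordered? : (inv : Inversion (s i · h)) → let a , b = proj₁ inv in Dec (s i ⟨ a ⟩ ℤ.< s i ⟨ b ⟩)
        ordered? ((a , b) , _) = s i ⟨ a ⟩ ℤ.<? s i ⟨ b ⟩

      length-s· : ∀ {M N} → HasLength (s i · h) M → HasLength h N → M ≤ suc N
      length-s· M↔ N↔ = Fin.injective⇒≤ (Injection.injective
        (↔⇒↣ (↔-sym Fin.+↔⊎ ↔-∘ (↔-id (Fin 1) ⊎-↔ N↔)) ↣-∘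
          (mk↣ {to = λ inv → shorten inv (ordered? inv)} (λ {x} {y} → shorten-injective x y (ordered? x) (ordered? y)) ↣-∘
            ↔⇒↣ (↔-sym M↔))))

  HasLength-ε : ∀ {M} → HasLength {n} ε M → M ≡ 0
  HasLength-ε {zero}  _   = refl
  HasLength-ε {suc M} bij = let _ , _ , a<b , b<a = Inverse.from bij Fin.zero in ⊥-elim (ℤ.<-asym a<b b<a)

  length-product : ∀ {m} (𝐠 : Word n m) 𝐮 {M} → HasLength (product 𝐠 𝐮) M → M ≤ ∣ 𝐮 ∣
  length-product []      []            M↔ = ℕ.≤-reflexive (HasLength-ε M↔)
  length-product (i ∷ 𝐠) (outside ∷ 𝐮) M↔ = length-product 𝐠 𝐮 M↔
  length-product (i ∷ 𝐠) (inside ∷ 𝐮)  M↔ =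
    let N , N↔ = hasLength (product 𝐠 𝐮)
    in ℕ.≤-trans (length-s· i (product 𝐠 𝐮) M↔ N↔) (ℕ.s≤s (length-product 𝐠 𝐮 N↔))

  BlockPreserving-partial : ∀ {m} {𝐰 : Word n m} → IsWordₛ 𝐰 → ∀ 𝐮 j → BlockPreserving (partial 𝐰 𝐮 j)
  BlockPreserving-partial _            _             Fin.zero    = BlockPreserving-ε
  BlockPreserving-partial {𝐰 = i ∷ 𝐰} (1≤i ∷ sw) (inside ∷ 𝐮) (Fin.suc j) =
    BlockPreserving-· {u = s i} {w = partial 𝐰 𝐮 j} (BlockPreserving-s i 1≤i) (BlockPreserving-partial sw 𝐮 j)
  BlockPreserving-partial {𝐰 = i ∷ 𝐰} (1≤i ∷ sw) (outside ∷ 𝐮) (Fin.suc j) = BlockPreserving-partial sw 𝐮 j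

  product-++ : ∀ {l m} (𝐱 : Word n l) (𝐰 : Word n m) 𝐮 𝐯 →
               product (𝐱 ++ 𝐰) (𝐮 ++ 𝐯) ≈ product 𝐱 𝐮 · product 𝐰 𝐯
  product-++ []      𝐰 []      𝐯 a = refl
  product-++ (i ∷ 𝐱) 𝐰 (c ∷ 𝐮) 𝐯 a = product-++ 𝐱 𝐰 𝐮 𝐯 (entry i c ⟨ a ⟩)

  elbows-prepend : ∀ l {m} (𝐮 : Subword m) → elbows (prepend l 𝐮) ≡ elbows 𝐮
  elbows-prepend zero    𝐮 = refl
  elbows-prepend (suc l) 𝐮 = elbows-prepend l 𝐮

  DistinguishedAfter : (AffPerm n → Set) → AffPerm n → ∀ {m} → Word n m → Subword m → Set
  DistinguishedAfter T g {m} 𝐠 𝐮 =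
    ∀ (j : Fin m) → Bruhat T (g · partial 𝐠 𝐮 (Fin.suc j)) (g · partial 𝐠 𝐮 (Fin.inject₁ j) · s (lookup 𝐠 j))

  module _ {T : AffPerm n → Set} {m : ℕ} {𝐰 : Word n m} {𝐮 : Subword m} where

    Distinguished-prepend⁺ : ∀ {l} (𝐱 : Word n l) g → DistinguishedAfter T (g · wordProduct 𝐱) 𝐰 𝐮 →
                             DistinguishedAfter T g (𝐱 ++ 𝐰) (prepend l 𝐮)
    Distinguished-prepend⁺ []      g dist j           = Bruhat-cong (λ _ → refl) (λ _ → refl) (dist j)
    Distinguished-prepend⁺ (i ∷ 𝐱) g dist Fin.zero    = equal (λ _ → refl)
    Distinguished-prepend⁺ (i ∷ 𝐱) g dist (Fin.suc j) = Bruhat-cong (λ _ → refl) (λ _ → refl)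
      (Distinguished-prepend⁺ 𝐱 (g · s i) (λ j → Bruhat-cong (λ _ → refl) (λ _ → refl) (dist j)) j)

    Distinguished-prepend⁻ : ∀ {l} (𝐱 : Word n l) g → DistinguishedAfter T g (𝐱 ++ 𝐰) (prepend l 𝐮) →
                             DistinguishedAfter T (g · wordProduct 𝐱) 𝐰 𝐮
    Distinguished-prepend⁻ []      g dist j = Bruhat-cong (λ _ → refl) (λ _ → refl) (dist j)
    Distinguished-prepend⁻ (i ∷ 𝐱) g dist j = Bruhat-cong (λ _ → refl) (λ _ → refl)
      (Distinguished-prepend⁻ 𝐱 (g · s i) (λ j → Bruhat-cong (λ _ → refl) (λ _ → refl) (dist (Fin.suc j))) j)

module _ {n : ℕ} .{{_ : NonTrivial n}} where

  BlockIncreasing-cong : ∀ {g h : AffPerm n} → g ≈ h → BlockIncreasing g → BlockIncreasing h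
  BlockIncreasing-cong {g} {h} g≈h g↑ eq lt = subst₂ ℤ._<_ (⁻¹-cong {y = g} {z = h} g≈h _) (⁻¹-cong {y = g} {z = h} g≈h _) (g↑ eq lt)

  BlockIncreasing-Λ : ∀ c {g : AffPerm n} → BlockIncreasing g → BlockIncreasing (Λ^ c · g)
  BlockIncreasing-Λ c g↑ eq lt = ℤ.+-monoˡ-< (- c) (g↑ eq lt)

  Λ-↪ : ∀ c (f : AffPerm n) → f ↪ Λ^ c · f
  Λ-↪ c f = along (Λ^ c ⁻¹) λ {a} {b} (a<b , lt) →
    ℤ.+-monoˡ-< (- c) a<b , subst₂ ℤ._<_ (sym (cong (f ⟨_⟩) (⁻¹-inverseʳ (Λ^ {n} c) b))) (sym (cong (f ⟨_⟩) (⁻¹-inverseʳ (Λ^ {n} c) a))) lt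

  ↪-Λ : ∀ c (f : AffPerm n) → Λ^ c · f ↪ f
  ↪-Λ c f = along (Λ^ c) λ (a<b , lt) → ℤ.+-monoˡ-< c a<b , lt

  module _ {g : AffPerm n} (g↑ : BlockIncreasing g) {u : AffPerm n} (bu : BlockPreserving u) where

    coset-↪ : g ↪ g · u
    coset-↪ = along ε λ {a} {b} (a<b , gb<ga) → a<b , block-mono-< (subst₂ ℤ._<_ (sym (bu (g ⟨ b ⟩))) (sym (bu (g ⟨ a ⟩)))
      (ℤ.≤∧≢⇒< (block-mono-≤ (ℤ.<⇒≤ gb<ga)) λ eq →
        ℤ.<-asym a<b (subst₂ ℤ._<_ (⁻¹-inverseˡ g b) (⁻¹-inverseˡ g a) (g↑ eq gb<ga))))

    right-↪ : u ↪ g · u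
    right-↪ = along (g ⁻¹) λ {c} {d} (c<d , ud<uc) →
      g↑ (ℤ.≤-antisym (block-mono-≤ (ℤ.<⇒≤ c<d))
           (subst₂ ℤ._≤_ (bu d) (bu c) (block-mono-≤ (ℤ.<⇒≤ ud<uc)))) c<d ,
      subst₂ ℤ._<_ (sym (cong (u ⟨_⟩) (⁻¹-inverseʳ g d))) (sym (cong (u ⟨_⟩) (⁻¹-inverseʳ g c))) ud<uc

    length-coset : ∀ {a b c} → HasLength g a → HasLength u b → HasLength (g · u) c → a + b ≤ c
    length-coset A B C = disjoint-≤ A B C (inversions-↣ {f = g} {g = g · u} coset-↪) (inversions-↣ {f = u} {g = g · u} right-↪)
      λ i j eq →
        let c , d = proj₁ j
            (a , b) , (_ , gb<ga) , eq′ , _ = mapInversion-image coset-↪ i {g ⁻¹ ⟨ c ⟩ , g ⁻¹ ⟨ d ⟩} (cong proj₁ eq)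
            a≡ = trans (cong (g ⟨_⟩) (cong proj₁ eq′)) (⁻¹-inverseʳ g c)
            b≡ = trans (cong (g ⟨_⟩) (cong proj₂ eq′)) (⁻¹-inverseʳ g d)
        in ℤ.<-asym (proj₁ (inverted u j)) (subst₂ ℤ._<_ b≡ a≡ gb<ga)

  ext-at : ∀ (w : Permutation′ n) i q → ext w ⟨ at i q ⟩ ≡ at (w ⟨$⟩ʳ i) q
  ext-at w i q = cong₂ (λ i q → at (w ⟨$⟩ʳ i) q) (residue-at i q) (block-at i q)

  ext-⁻¹-at : ∀ (w : Permutation′ n) j q → ext w ⁻¹ ⟨ at (w ⟨$⟩ʳ j) q ⟩ ≡ at j q
  ext-⁻¹-at w j q = trans (cong (ext w ⁻¹ ⟨_⟩) (sym (ext-at w j q))) (⁻¹-inverseˡ (ext w) (at j q))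

  ext-pos : ∀ (w : Permutation′ n) i → ext w ⟨ pos i ⟩ ≡ pos (w ⟨$⟩ʳ i)
  ext-pos w i = trans (cong (ext w ⟨_⟩) (pos≡at-0 i)) (trans (ext-at w i 0ℤ) (sym (pos≡at-0 (w ⟨$⟩ʳ i))))

  translation-in : ∀ (S : Fin n → Bool) {i} q → S i ≡ true → translation S ⟨ at i q ⟩ ≡ at i (q ℤ.+ 1ℤ)
  translation-in S {i} q eq = trans (cong (if_then at i q ℤ.+ + n else at i q) (trans (cong S (residue-at i q)) eq)) (sym (at-+n i q))

  translation-out : ∀ (S : Fin n → Bool) {i} q → S i ≡ false → translation S ⟨ at i q ⟩ ≡ at i q
  translation-out S {i} q eq = cong (if_then at i q ℤ.+ + n else at i q) (trans (cong S (residue-at i q)) eq)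

  translation⁻¹-in : ∀ (S : Fin n → Bool) {i} q → S i ≡ true → translation S ⁻¹ ⟨ at i q ⟩ ≡ at i (q ℤ.- 1ℤ)
  translation⁻¹-in S {i} q eq = trans (cong (if_then at i q ℤ.- + n else at i q) (trans (cong S (residue-at i q)) eq)) (lem (pos i) q (+ n))
    where
    lem : ∀ p q n → p ℤ.+ q ℤ.* n ℤ.- n ≡ p ℤ.+ (q ℤ.- 1ℤ) ℤ.* n
    lem = solve-∀

  translation⁻¹-out : ∀ (S : Fin n → Bool) {i} q → S i ≡ false → translation S ⁻¹ ⟨ at i q ⟩ ≡ at i q
  translation⁻¹-out S {i} q eq = cong (if_then at i q ℤ.- + n else at i q) (trans (cong S (residue-at i q)) eq)

  pos-cancel-< : ∀ {i j : Fin n} q → at i q ℤ.< at j q → i Fin.< j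
  pos-cancel-< {i} {j} q lt = ℕ.s<s⁻¹ (ℤ.drop‿+<+ (+-cancelʳ-< (q ℤ.* + n) lt))

  at-monoˡ-≤ : ∀ {i j : Fin n} q → i Fin.≤ j → at i q ℤ.≤ at j q
  at-monoˡ-≤ q i≤j = ℤ.+-monoˡ-≤ (q ℤ.* + n) (ℤ.+≤+ (ℕ.s≤s i≤j))

  at-monoˡ-< : ∀ {i j : Fin n} q → i Fin.< j → at i q ℤ.< at j q
  at-monoˡ-< q i<j = ℤ.+-monoˡ-< (q ℤ.* + n) (ℤ.+<+ (ℕ.s<s i<j))

  at-monoʳ-≤ : ∀ (i : Fin n) {q r} → q ℤ.≤ r → at i q ℤ.≤ at i r
  at-monoʳ-≤ i q≤r = ℤ.+-monoʳ-≤ (pos i) (ℤ.*-monoʳ-≤-nonNeg (+ n) q≤r)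

  via-at : ∀ (w : Permutation′ n) {P : ℤ → Set} → (∀ j q → P (at (w ⟨$⟩ʳ j) q)) → ∀ a → P a
  via-at w {P} p a = subst P
    (trans (cong (λ i → at i (block {n} a)) (Perm.inverseʳ w)) (at-residue {n} a))
    (p (w ⟨$⟩ˡ residue {n} a) (block {n} a))

  module _ (k : ℕ) (w : Permutation′ n) where

    image-in : ∀ {j} → toℕ j ℕ.< k → does (image? w k (w ⟨$⟩ʳ j)) ≡ true
    image-in {j} j<k = dec-true (image? w k (w ⟨$⟩ʳ j)) (j , j<k , refl)

    image-out : ∀ {j} → ¬ toℕ j ℕ.< k → does (image? w k (w ⟨$⟩ʳ j)) ≡ false
    image-out {j} j≮k = dec-false (image? w k (w ⟨$⟩ʳ j)) λ (j′ , j′<k , eq) →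
      j≮k (subst (λ j → toℕ j ℕ.< k) (trans (sym (Perm.inverseˡ w)) (trans (cong (w ⟨$⟩ˡ_) eq) (Perm.inverseˡ w))) j′<k)

    module _ (v : Permutation′ n) where

      f-low : ∀ {j} q → toℕ j ℕ.< k → f[ v , w ] k ⟨ at (w ⟨$⟩ʳ j) q ⟩ ≡ at (v ⟨$⟩ʳ j) (q ℤ.+ 1ℤ)
      f-low {j} q j<k = begin
        ext v ⟨ τ k ⟨ ext w ⁻¹ ⟨ at (w ⟨$⟩ʳ j) q ⟩ ⟩ ⟩  ≡⟨ cong (λ a → ext v ⟨ τ k ⟨ a ⟩ ⟩) (ext-⁻¹-at w j q) ⟩
        ext v ⟨ τ k ⟨ at j q ⟩ ⟩                        ≡⟨ cong (ext v ⟨_⟩) (translation-in (λ i → does (toℕ i ℕ.<? k)) q (dec-true (toℕ j ℕ.<? k) j<k)) ⟩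
        ext v ⟨ at j (q ℤ.+ 1ℤ) ⟩                       ≡⟨ ext-at v j (q ℤ.+ 1ℤ) ⟩
        at (v ⟨$⟩ʳ j) (q ℤ.+ 1ℤ)                        ∎
        where open ≡-Reasoning

      f-high : ∀ {j} q → ¬ toℕ j ℕ.< k → f[ v , w ] k ⟨ at (w ⟨$⟩ʳ j) q ⟩ ≡ at (v ⟨$⟩ʳ j) q
      f-high {j} q j≮k = begin
        ext v ⟨ τ k ⟨ ext w ⁻¹ ⟨ at (w ⟨$⟩ʳ j) q ⟩ ⟩ ⟩  ≡⟨ cong (λ a → ext v ⟨ τ k ⟨ a ⟩ ⟩) (ext-⁻¹-at w j q) ⟩
        ext v ⟨ τ k ⟨ at j q ⟩ ⟩                        ≡⟨ cong (ext v ⟨_⟩) (translation-out (λ i → does (toℕ i ℕ.<? k)) q (dec-false (toℕ j ℕ.<? k) j≮k)) ⟩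
        ext v ⟨ at j q ⟩                                ≡⟨ ext-at v j q ⟩
        at (v ⟨$⟩ʳ j) q                                 ∎
        where open ≡-Reasoning

    module _ (grass : IsGrassmannian k w) where

      x-increasing : BlockIncreasing (x k w)
      x-increasing {c} {d} bc≡bd c<d = subst₂ (λ c d → x k w ⁻¹ ⟨ c ⟩ ℤ.< x k w ⁻¹ ⟨ d ⟩) (at-residue {n} c) d≡
        (increasing (toℕ i ℕ.<? k) (toℕ j ℕ.<? k))
        where
        i = residue {n} c
        j = residue {n} d
        q = block {n} c
        d≡ : at j q ≡ d
        d≡ = trans (cong (at j) bc≡bd) (at-residue {n} d)
        i<j : i Fin.< j
        i<j = pos-cancel-< {i} {j} q (subst₂ ℤ._<_ (sym (at-residue {n} c)) (sym d≡) c<d)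
        S : Fin n → Bool
        S i = does (toℕ i ℕ.<? k)
        low : ∀ {i} → toℕ i ℕ.< k → x k w ⁻¹ ⟨ at i q ⟩ ≡ at (w ⟨$⟩ʳ i) (q ℤ.- 1ℤ)
        low {i} i<k = trans (cong (ext w ⟨_⟩) (translation⁻¹-in S q (dec-true (toℕ i ℕ.<? k) i<k))) (ext-at w i (q ℤ.- 1ℤ))
        high : ∀ {i} → ¬ toℕ i ℕ.< k → x k w ⁻¹ ⟨ at i q ⟩ ≡ at (w ⟨$⟩ʳ i) q
        high {i} i≮k = trans (cong (ext w ⟨_⟩) (translation⁻¹-out S q (dec-false (toℕ i ℕ.<? k) i≮k))) (ext-at w i q)
        increasing : Dec (toℕ i ℕ.< k) → Dec (toℕ j ℕ.< k) → x k w ⁻¹ ⟨ at i q ⟩ ℤ.< x k w ⁻¹ ⟨ at j q ⟩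
        increasing (yes i<k) (yes j<k) = subst₂ ℤ._<_ (sym (low i<k)) (sym (low j<k)) (at-monoˡ-< (q ℤ.- 1ℤ) (proj₁ grass i j i<j j<k))
        increasing (yes i<k) (no j≮k)  = subst₂ ℤ._<_ (sym (low i<k)) (sym (high j≮k)) (at-mono-< (w ⟨$⟩ʳ i) (w ⟨$⟩ʳ j) q-1<q)
          where
          q-1<q : q ℤ.- 1ℤ ℤ.< q
          q-1<q = subst (q ℤ.- 1ℤ ℤ.<_) (ℤ.+-identityʳ q) (ℤ.+-monoʳ-< q ℤ.-<+)
        increasing (no i≮k)  (yes j<k) = ⊥-elim (i≮k (ℕ.<-trans i<j j<k))
        increasing (no i≮k)  (no j≮k)  = subst₂ ℤ._<_ (sym (high i≮k)) (sym (high j≮k)) (at-monoˡ-< q (proj₂ grass i j i<j (ℕ.≮⇒≥ i≮k)))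

-- Bounded affine permutations

at-lex-≤ : ∀ {n} .{{_ : NonTrivial n}} {i j : Fin n} {q r} → q ℤ.≤ r → (q ≡ r → i Fin.≤ j) → at i q ℤ.≤ at j r
at-lex-≤ {i = i} {j} {q} {r} q≤r i≤j with ℤ.<-cmp q r
... | tri< q<r _ _ = ℤ.<⇒≤ (at-mono-< i j q<r)
... | tri≈ _ refl _ = at-monoˡ-≤ q (i≤j refl)
... | tri> _ _ r<q = ⊥-elim (ℤ.<⇒≱ r<q q≤r)

sum-below : ∀ m k N → k ≤ m → sum {m} (λ j → (if does (toℕ j ℕ.<? k) then 1ℤ else 0ℤ) ℤ.* N) ≡ + k ℤ.* N
sum-below zero    zero    N _ = sym (ℤ.*-zeroˡ N)
sum-below (suc m) zero    N _ = trans (cong₂ ℤ._+_ (ℤ.*-zeroˡ N) (sum-below m zero N ℕ.z≤n)) (ℤ.+-identityˡ (0ℤ ℤ.* N))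
sum-below (suc m) (suc k) N (ℕ.s≤s k≤m) = trans (cong (λ z → 1ℤ ℤ.* N ℤ.+ z) (sum-below m k N k≤m)) (sym (ℤ.*-distribʳ-+ N 1ℤ (+ k)))

module _ {n : ℕ} .{{_ : NonTrivial n}} (k : ℕ) (w : Permutation′ n) where

  module _ (grass : IsGrassmannian k w) (v : Permutation′ n) (v≤w : v ≤ₛ w) where

    v≤w-low : ∀ {j} → toℕ j ℕ.< k → v ⟨$⟩ʳ j Fin.≤ w ⟨$⟩ʳ j
    v≤w-low {j} j<k = ℕ.s≤s⁻¹ (ℤ.drop‿+≤+ (subst (ℤ._≤ pos (w ⟨$⟩ʳ j)) (ext-pos v j)
      (Bruhat-upper (Bruhatₛ⇒Bruhat v≤w) bound (pos j) ℤ.≤-refl)))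
      where
      bound : ∀ a → a ℤ.≤ pos j → ext w ⟨ a ⟩ ℤ.≤ pos (w ⟨$⟩ʳ j)
      bound a a≤j = subst (ext w ⟨ a ⟩ ℤ.≤_) (sym (pos≡at-0 (w ⟨$⟩ʳ j)))
        (at-lex-≤ {q = block {n} a} {0ℤ} (subst (block {n} a ℤ.≤_) (block-pos j) (block-mono-≤ a≤j)) λ eq →
          mono (ℕ.s≤s⁻¹ (ℤ.drop‿+≤+ (subst (ℤ._≤ pos j)
            (trans (sym (at-residue {n} a)) (trans (cong (at (residue {n} a)) eq) (sym (pos≡at-0 (residue {n} a))))) a≤j))))
        where
        mono : ∀ {i} → i Fin.≤ j → w ⟨$⟩ʳ i Fin.≤ w ⟨$⟩ʳ j
        mono {i} i≤j with ℕ.m≤n⇒m<n∨m≡n i≤j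
        ... | inj₁ i<j = ℕ.<⇒≤ (proj₁ grass i j i<j j<k)
        ... | inj₂ i≡j = ℕ.≤-reflexive (cong (λ i → toℕ (w ⟨$⟩ʳ i)) (Fin.toℕ-injective i≡j))

    v≥w-high : ∀ {j} → k ≤ toℕ j → w ⟨$⟩ʳ j Fin.≤ v ⟨$⟩ʳ j
    v≥w-high {j} k≤j = ℕ.s≤s⁻¹ (ℤ.drop‿+≤+ (subst (pos (w ⟨$⟩ʳ j) ℤ.≤_) (ext-pos v j)
      (Bruhat-lower (Bruhatₛ⇒Bruhat v≤w) bound (pos j) ℤ.≤-refl)))
      where
      bound : ∀ a → pos j ℤ.≤ a → pos (w ⟨$⟩ʳ j) ℤ.≤ ext w ⟨ a ⟩
      bound a j≤a = subst (ℤ._≤ ext w ⟨ a ⟩) (sym (pos≡at-0 (w ⟨$⟩ʳ j)))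
        (at-lex-≤ {q = 0ℤ} {block {n} a} (subst (ℤ._≤ block {n} a) (block-pos j) (block-mono-≤ j≤a)) λ eq →
          mono (ℕ.s≤s⁻¹ (ℤ.drop‿+≤+ (subst (pos j ℤ.≤_)
            (trans (sym (at-residue {n} a)) (trans (cong (at (residue {n} a)) (sym eq)) (sym (pos≡at-0 (residue {n} a))))) j≤a))))
        where
        mono : ∀ {i} → j Fin.≤ i → w ⟨$⟩ʳ j Fin.≤ w ⟨$⟩ʳ i
        mono {i} j≤i with ℕ.m≤n⇒m<n∨m≡n j≤i
        ... | inj₁ j<i = ℕ.<⇒≤ (proj₂ grass j i j<i k≤j)
        ... | inj₂ j≡i = ℕ.≤-reflexive (cong (λ i → toℕ (w ⟨$⟩ʳ i)) (Fin.toℕ-injective j≡i))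

    f-bounded : ∀ a → a ℤ.≤ f[ v , w ] k ⟨ a ⟩ × f[ v , w ] k ⟨ a ⟩ ℤ.≤ a ℤ.+ + n
    f-bounded = via-at w λ j q → bounds j q (toℕ j ℕ.<? k)
      where
      q<q+1 : ∀ q → q ℤ.< q ℤ.+ 1ℤ
      q<q+1 q = <-+-suc q 0
      bounds : ∀ j q → Dec (toℕ j ℕ.< k) → let a = at (w ⟨$⟩ʳ j) q in
               a ℤ.≤ f[ v , w ] k ⟨ a ⟩ × f[ v , w ] k ⟨ a ⟩ ℤ.≤ a ℤ.+ + n
      bounds j q (yes j<k) =
        subst₂ (λ b c → at (w ⟨$⟩ʳ j) q ℤ.≤ b × b ℤ.≤ c) (sym (f-low k w v q j<k)) (at-+n (w ⟨$⟩ʳ j) q)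
          (ℤ.<⇒≤ (at-mono-< (w ⟨$⟩ʳ j) (v ⟨$⟩ʳ j) (q<q+1 q)) , at-monoˡ-≤ (q ℤ.+ 1ℤ) (v≤w-low j<k))
      bounds j q (no j≮k) =
        subst₂ (λ b c → at (w ⟨$⟩ʳ j) q ℤ.≤ b × b ℤ.≤ c) (sym (f-high k w v q j≮k)) (at-+n (w ⟨$⟩ʳ j) q)
          (at-monoˡ-≤ q (v≥w-high (ℕ.≮⇒≥ j≮k)) , ℤ.<⇒≤ (at-mono-< (v ⟨$⟩ʳ j) (w ⟨$⟩ʳ j) (q<q+1 q)))

  f-average : ∀ v → k ≤ n → HasAverage k (f[ v , w ] k)
  f-average v k≤n = +-cancelˡ (sum {n} pos) _ (+ k ℤ.* + n) (begin
    sum {n} pos ℤ.+ sum {n} (λ i → f ⟨ pos i ⟩ ℤ.- pos i)     ≡⟨ ∑-distrib-+ {n} pos (λ i → f ⟨ pos i ⟩ ℤ.- pos i) ⟨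
    sum {n} (λ i → pos i ℤ.+ (f ⟨ pos i ⟩ ℤ.- pos i))         ≡⟨ sum-cong-≗ {n} (λ i → lem (pos i) (f ⟨ pos i ⟩)) ⟩
    sum {n} (λ i → f ⟨ pos i ⟩)                               ≡⟨ sum-permute {n} {n} (λ i → f ⟨ pos i ⟩) w ⟩
    sum {n} (λ j → f ⟨ pos (w ⟨$⟩ʳ j) ⟩)                      ≡⟨ sum-cong-≗ {n} (λ j → value j (toℕ j ℕ.<? k)) ⟩
    sum {n} (λ j → pos (v ⟨$⟩ʳ j) ℤ.+ c j ℤ.* + n)            ≡⟨ ∑-distrib-+ {n} (λ j → pos (v ⟨$⟩ʳ j)) (λ j → c j ℤ.* + n) ⟩
    sum {n} (λ j → pos (v ⟨$⟩ʳ j)) ℤ.+ sum {n} (λ j → c j ℤ.* + n) ≡⟨ cong₂ ℤ._+_ (sym (sum-permute {n} {n} pos v)) (sum-below n k (+ n) k≤n) ⟩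
    sum {n} pos ℤ.+ + k ℤ.* + n                           ∎)
    where
    open ≡-Reasoning
    f = f[ v , w ] k
    c : Fin n → ℤ
    c j = if does (toℕ j ℕ.<? k) then 1ℤ else 0ℤ
    lem : ∀ p f → p ℤ.+ (f ℤ.- p) ≡ f
    lem = solve-∀
    value : ∀ j → Dec (toℕ j ℕ.< k) → f ⟨ pos (w ⟨$⟩ʳ j) ⟩ ≡ pos (v ⟨$⟩ʳ j) ℤ.+ c j ℤ.* + n
    value j (yes j<k) = trans (cong (f ⟨_⟩) (pos≡at-0 (w ⟨$⟩ʳ j))) (trans (f-low k w v 0ℤ j<k)
      (cong (λ b → pos (v ⟨$⟩ʳ j) ℤ.+ (if b then 1ℤ else 0ℤ) ℤ.* + n) (sym (dec-true (toℕ j ℕ.<? k) j<k))))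
    value j (no j≮k)  = trans (cong (f ⟨_⟩) (pos≡at-0 (w ⟨$⟩ʳ j))) (trans (f-high k w v 0ℤ j≮k)
      (cong (λ b → pos (v ⟨$⟩ʳ j) ℤ.+ (if b then 1ℤ else 0ℤ) ℤ.* + n) (sym (dec-false (toℕ j ℕ.<? k) j≮k))))

  image≐I₁ : ∀ v → image w k ≐ I₁ (f[ v , w ] k)
  image≐I₁ v = to , from
    where
    to : ∀ {i} → image w k i → I₁ (f[ v , w ] k) i
    to (j , j<k , refl) = at (w ⟨$⟩ʳ j) (- 1ℤ) ,
      block-mono-< (subst₂ ℤ._<_ (sym (block-at (w ⟨$⟩ʳ j) (- 1ℤ))) (sym (block-window ℤ.≤-refl (ℤ.+≤+ (ℕ.<⇒≤ (ℕ.nonTrivial⇒n>1 n))))) ℤ.-<+) ,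
      subst (1ℤ ℤ.≤_) (sym (trans (f-low k w v (- 1ℤ) j<k) (sym (pos≡at-0 (v ⟨$⟩ʳ j))))) (proj₁ (window-pos (v ⟨$⟩ʳ j))) ,
      residue-at (w ⟨$⟩ʳ j) (- 1ℤ)
    from : ∀ {i} → I₁ (f[ v , w ] k) i → image w k i
    from (a , a<1 , 1≤fa , refl) = via-at w {λ a → a ℤ.< 1ℤ → 1ℤ ℤ.≤ f[ v , w ] k ⟨ a ⟩ → image w k (residue {n} a)}
      (λ j q → below j q (toℕ j ℕ.<? k)) a a<1 1≤fa
      where
      below : ∀ j q → Dec (toℕ j ℕ.< k) → at (w ⟨$⟩ʳ j) q ℤ.< 1ℤ → 1ℤ ℤ.≤ f[ v , w ] k ⟨ at (w ⟨$⟩ʳ j) q ⟩ →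
              image w k (residue {n} (at (w ⟨$⟩ʳ j) q))
      below j q (yes j<k) _ _ = j , j<k , sym (residue-at (w ⟨$⟩ʳ j) q)
      below j q (no j≮k) a<1 1≤fa = ⊥-elim (ℤ.<⇒≱ a<1 (begin
        1ℤ                    ≤⟨ proj₁ (window-pos (w ⟨$⟩ʳ j)) ⟩
        pos (w ⟨$⟩ʳ j)        ≡⟨ pos≡at-0 (w ⟨$⟩ʳ j) ⟩
        at (w ⟨$⟩ʳ j) 0ℤ      ≤⟨ at-monoʳ-≤ (w ⟨$⟩ʳ j) 0≤q ⟩
        at (w ⟨$⟩ʳ j) q       ∎))
        where
        open ℤ.≤-Reasoning
        0≤q : 0ℤ ℤ.≤ q
        0≤q = subst₂ ℤ._≤_ (block-window ℤ.≤-refl (ℤ.+≤+ (ℕ.<⇒≤ (ℕ.nonTrivial⇒n>1 n)))) (block-at (v ⟨$⟩ʳ j) q)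
          (block-mono-≤ (subst (1ℤ ℤ.≤_) (f-high k w v q j≮k) 1≤fa))

  module _ (k≤n : k ≤ n) where

    lookup-path : ∀ i → lookup (steps (path k k≤n w)) i ≡ (if does (image? w k i) then up else right)
    lookup-path i = lookup∘tabulate (λ i → if does (image? w k i) then up else right) i

    upSteps≐image : upSteps (path k k≤n w) ≐ image w k
    upSteps≐image = (λ {i} eq → to (trans (sym (lookup-path i)) eq)) ,
      λ {i} im → trans (lookup-path i) (cong (if_then up else right) (dec-true (image? w k i) im))
      where
      to : ∀ {i} → (if does (image? w k i) then up else right) ≡ up → image w k i
      to {i} eq with image? w k i
      ... | yes im = im

    isUp-path : ∀ i → isUp (lookup (steps (path k k≤n w)) i) ≡ does (image? w k i)
    isUp-path i = trans (cong isUp (lookup-path i)) (isUp-if (does (image? w k i)))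
      where
      isUp-if : ∀ b → isUp (if b then up else right) ≡ b
      isUp-if true  = refl
      isUp-if false = refl

    τₚ≈f : τₚ (path k k≤n w) ≈ f[ w , w ] k
    τₚ≈f = via-at w λ j q → value j q (toℕ j ℕ.<? k)
      where
      S : Fin n → Bool
      S i = isUp (lookup (steps (path k k≤n w)) i)
      value : ∀ j q → Dec (toℕ j ℕ.< k) → τₚ (path k k≤n w) ⟨ at (w ⟨$⟩ʳ j) q ⟩ ≡ f[ w , w ] k ⟨ at (w ⟨$⟩ʳ j) q ⟩
      value j q (yes j<k) = trans (translation-in S q (trans (isUp-path _) (image-in k w j<k))) (sym (f-low k w w q j<k))
      value j q (no j≮k)  = trans (translation-out S q (trans (isUp-path _) (image-out k w j≮k))) (sym (f-high k w w q j≮k))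

restrictsToBijection : ∀ {A B : Set} {φ : A → B} {P : A → Set} {Q : B → Set} →
  (∀ {x y} → φ x ≡ φ y → x ≡ y) → (∀ {x} → P x → Q (φ x)) → (∀ {y} → Q y → ∃[ x ] P x × φ x ≡ y) →
  RestrictsToBijection φ P Q
restrictsToBijection {φ = φ} inj preserves surj = record
  { to        = λ (x , p) → φ x , preserves p
  ; cong      = cong φ
  ; bijective = inj , λ (y , q) → let x , p , eq = surj q in (x , p) , λ { refl → eq }
  } , λ _ → refl

module _ {n : ℕ} .{{_ : NonTrivial n}} (k : ℕ) (w : Permutation′ n) (grass : IsGrassmannian k w)
         {l m : ℕ} (𝐱 : Word n l) (𝐰 : Word n m)
         (x-reduced : IsReducedWord k (x k w) 𝐱) (w-reduced : IsReducedWordₛ w 𝐰) where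

  private
    g : AffPerm n
    g = wordProduct 𝐱

    c : ℤ
    c = - + k

    g≈Λx : g ≈ Λ^ c · x k w
    g≈Λx = proj₁ x-reduced

    g↑ : BlockIncreasing g
    g↑ = BlockIncreasing-cong {g = Λ^ c · x k w} {h = g} (λ a → sym (g≈Λx a)) (BlockIncreasing-Λ c {x k w} (x-increasing k w grass))

  length-prefix : ∀ {M} → HasLength g M → l ≡ M
  length-prefix M↔ = ↪-antisym {f = x k w} {g = g}
    (↪-trans {f = x k w} {g = Λ^ c · x k w} {h = g} (Λ-↪ c (x k w)) (↪-cong {f = Λ^ c · x k w} {g = g} (λ a → sym (g≈Λx a))))
    (↪-trans {f = g} {g = Λ^ c · x k w} {h = x k w} (↪-cong {f = g} {g = Λ^ c · x k w} g≈Λx) (↪-Λ c (x k w)))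
    (proj₂ x-reduced) M↔

  τₚ-reduced : (k≤n : k ≤ n) → IsReducedWord k (τₚ (path k k≤n w)) (𝐱 ++ 𝐰)
  τₚ-reduced k≤n = word≈ , subst (HasLength τP) (sym l+m≡N) N↔
    where
    τP = τₚ (path k k≤n w)
    replicate-++ : ∀ l {m} → prepend l (replicate m inside) ≡ replicate (l + m) inside
    replicate-++ zero    = refl
    replicate-++ (suc l) = cong (inside ∷_) (replicate-++ l)
    word≈ : wordProduct (𝐱 ++ 𝐰) ≈ Λ^ c · τP
    word≈ a = begin
      product (𝐱 ++ 𝐰) (replicate (l + m) inside) ⟨ a ⟩        ≡⟨ cong (λ 𝐮 → product (𝐱 ++ 𝐰) 𝐮 ⟨ a ⟩) (replicate-++ l) ⟨
      product (𝐱 ++ 𝐰) (prepend l (replicate m inside)) ⟨ a ⟩  ≡⟨ product-++ 𝐱 𝐰 (replicate l inside) (replicate m inside) a ⟩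
      wordProduct 𝐰 ⟨ g ⟨ a ⟩ ⟩                                ≡⟨ trans (proj₁ (proj₂ w-reduced) (g ⟨ a ⟩)) (cong (ext w ⟨_⟩) (g≈Λx a)) ⟩
      f[ w , w ] k ⟨ a ℤ.+ c ⟩                                 ≡⟨ τₚ≈f k w k≤n (a ℤ.+ c) ⟨
      τP ⟨ a ℤ.+ c ⟩                                           ∎
      where open ≡-Reasoning
    N  = proj₁ (hasLength τP)
    N↔ = proj₂ (hasLength τP)
    M  = proj₁ (hasLength (wordProduct (𝐱 ++ 𝐰)))
    M↔ = proj₂ (hasLength (wordProduct (𝐱 ++ 𝐰)))
    l+m≡N : l + m ≡ N
    l+m≡N = ℕ.≤-antisym
      (length-coset {g = x k w} (x-increasing k w grass) {u = ext w} (BlockPreserving-ext w) (proj₂ x-reduced) (proj₂ (proj₂ w-reduced))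
        (HasLength-cong {f = τP} {g = x k w · ext w} (τₚ≈f k w k≤n) N↔))
      (ℕ.≤-trans (HasLength-≤ {f = τP} {g = wordProduct (𝐱 ++ 𝐰)}
          (↪-trans {f = τP} {g = Λ^ c · τP} {h = wordProduct (𝐱 ++ 𝐰)} (Λ-↪ c τP)
            (↪-cong {f = Λ^ c · τP} {g = wordProduct (𝐱 ++ 𝐰)} (λ a → sym (word≈ a)))) N↔ M↔)
        (ℕ.≤-trans (length-product (𝐱 ++ 𝐰) (replicate (l + m) inside) M↔) (ℕ.≤-reflexive (∣⊤∣≡n (l + m)))))

  module _ (v : Permutation′ n) where

    prepend-preserves : ∀ {r 𝐮} → 𝒟 r v 𝐰 𝐮 → 𝒜 r k (f[ v , w ] k) (𝐱 ++ 𝐰) (prepend l 𝐮)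
    prepend-preserves {𝐮 = 𝐮} (dist , prod , elb) =
      (λ j → Bruhat-cong (λ _ → refl) (λ _ → refl) (Distinguished-prepend⁺ 𝐱 ε (λ j →
        Bruhat-cong (λ _ → refl) (λ _ → refl)
          (Bruhat-coset⁺ g g↑ (BlockPreserving-partial (proj₁ w-reduced) 𝐮 (Fin.suc j)) (dist j))) j)) ,
      (λ a → trans (product-++ 𝐱 𝐰 (replicate l inside) 𝐮 a) (trans (prod (g ⟨ a ⟩)) (cong (ext v ⟨_⟩) (g≈Λx a)))) ,
      trans (elbows-prepend l 𝐮) elb

    prepend-reflects : ∀ {r 𝐮} → 𝒜 r k (f[ v , w ] k) (𝐱 ++ 𝐰) (prepend l 𝐮) → 𝒟 r v 𝐰 𝐮
    prepend-reflects {𝐮 = 𝐮} (dist , prod , elb) =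
      (λ j → Bruhat-coset⁻ g g↑ (BlockPreserving-partial (proj₁ w-reduced) 𝐮 (Fin.suc j))
        (BlockPreserving-· {u = partial 𝐰 𝐮 (Fin.inject₁ j)} {w = s (lookup 𝐰 j)}
          (BlockPreserving-partial (proj₁ w-reduced) 𝐮 (Fin.inject₁ j)) (BlockPreserving-lookup (proj₁ w-reduced) j))
        (λ _ → refl) (λ _ → refl)
        (Distinguished-prepend⁻ 𝐱 ε (λ j → Bruhat-cong (λ _ → refl) (λ _ → refl) (dist j)) j)) ,
      (λ a → begin
        product 𝐰 𝐮 ⟨ a ⟩                        ≡⟨ cong (product 𝐰 𝐮 ⟨_⟩) (⁻¹-inverseʳ g a) ⟨
        product 𝐰 𝐮 ⟨ g ⟨ g ⁻¹ ⟨ a ⟩ ⟩ ⟩         ≡⟨ product-++ 𝐱 𝐰 (replicate l inside) 𝐮 (g ⁻¹ ⟨ a ⟩) ⟨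
        product (𝐱 ++ 𝐰) (prepend l 𝐮) ⟨ g ⁻¹ ⟨ a ⟩ ⟩ ≡⟨ prod (g ⁻¹ ⟨ a ⟩) ⟩
        ext v ⟨ (Λ^ c · x k w) ⟨ g ⁻¹ ⟨ a ⟩ ⟩ ⟩   ≡⟨ cong (ext v ⟨_⟩) (trans (sym (g≈Λx (g ⁻¹ ⟨ a ⟩))) (⁻¹-inverseʳ g a)) ⟩
        ext v ⟨ a ⟩                              ∎) ,
      trans (sym (elbows-prepend l 𝐮)) elb
      where
      open ≡-Reasoning
      BlockPreserving-lookup : ∀ {m} {𝐰 : Word n m} → IsWordₛ 𝐰 → ∀ j → BlockPreserving (s (lookup 𝐰 j))
      BlockPreserving-lookup {𝐰 = i ∷ _} (1≤i ∷ _) Fin.zero    = BlockPreserving-s i 1≤i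
      BlockPreserving-lookup {𝐰 = _ ∷ _} (_ ∷ sw)  (Fin.suc j) = BlockPreserving-lookup sw j

    -- The prefix has product in g S_n, whose shortest element g has length l.
    prefix-full : ∀ {𝐮 : Subword l} {𝐯 : Subword m} → product (𝐱 ++ 𝐰) (𝐮 ++ 𝐯) ≈ Λ^ c · f[ v , w ] k → 𝐮 ≡ replicate l inside
    prefix-full {𝐮} {𝐯} prod = ∣p∣≡n⇒p≡⊤ (ℕ.≤-antisym (∣p∣≤n 𝐮) (begin
      l         ≡⟨ length-prefix L↔ ⟩
      L         ≤⟨ HasLength-≤ {f = g} {g = product 𝐱 𝐮} embed L↔ M↔ ⟩
      M         ≤⟨ length-product 𝐱 𝐮 M↔ ⟩
      ∣ 𝐮 ∣     ∎))
      where
      open ℕ.≤-Reasoning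
      L  = proj₁ (hasLength g)
      L↔ = proj₂ (hasLength g)
      M  = proj₁ (hasLength (product 𝐱 𝐮))
      M↔ = proj₂ (hasLength (product 𝐱 𝐮))
      z y : AffPerm n
      z = product 𝐰 𝐯
      y = ext v · z ⁻¹
      y-preserving : BlockPreserving y
      y-preserving = BlockPreserving-· {u = ext v} {w = z ⁻¹} (BlockPreserving-ext v)
        (BlockPreserving-⁻¹ {u = z} (BlockPreserving-partial (proj₁ w-reduced) 𝐯 (Fin.fromℕ m)))
      gy≈ : g · y ≈ product 𝐱 𝐮
      gy≈ a = trans (cong (z ⁻¹ ⟨_⟩) (trans (cong (ext v ⟨_⟩) (g≈Λx a)) (trans (sym (prod a)) (product-++ 𝐱 𝐰 𝐮 𝐯 a))))
                    (⁻¹-inverseˡ z (product 𝐱 𝐮 ⟨ a ⟩))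
      embed : g ↪ product 𝐱 𝐮
      embed = ↪-trans {f = g} {g = g · y} {h = product 𝐱 𝐮} (coset-↪ {g = g} g↑ {u = y} y-preserving) (↪-cong {f = g · y} {g = product 𝐱 𝐮} gy≈)

    prepend-bijection : ∀ r → RestrictsToBijection (prepend l) (𝒟 r v 𝐰) (𝒜 r k (f[ v , w ] k) (𝐱 ++ 𝐰))
    prepend-bijection r = restrictsToBijection
      (++-injectiveʳ (replicate l inside) (replicate l inside)) prepend-preserves surjective
      where
      f = f[ v , w ] k
      surjective : ∀ {𝐮} → 𝒜 r k f (𝐱 ++ 𝐰) 𝐮 → ∃[ 𝐯 ] 𝒟 r v 𝐰 𝐯 × prepend l 𝐯 ≡ 𝐮
      surjective {𝐮} 𝐮∈𝒜@(_ , prod , _) =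
        let 𝐮₁ , 𝐮₂ , eq = Vec.splitAt l 𝐮
            full = prefix-full {𝐮₁} {𝐮₂} (subst (λ 𝐮 → product (𝐱 ++ 𝐰) 𝐮 ≈ Λ^ c · f) eq prod)
            eq′  = trans eq (cong (_++ 𝐮₂) full)
        in 𝐮₂ , prepend-reflects (subst (𝒜 r k f (𝐱 ++ 𝐰)) eq′ 𝐮∈𝒜) , sym eq′

corollary3p12 : ∀ (n : ℕ) .{{_ : NonTrivial n}} (k : ℕ) (k≤n : k ≤ n)
    (v w : Permutation′ n) → v ≤ₛ w → IsGrassmannian k w →
    ∀ {l m} (𝐱 : Word n l) (𝐰 : Word n m) →
    IsReducedWord k (x k w) 𝐱 → IsReducedWordₛ w 𝐰 →
    let f = f[ v , w ] k
        P = path k k≤n w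
    in
    𝐁 k f ×
    IsReducedWord k (τₚ P) (𝐱 ++ 𝐰) ×
    (∀ r → RestrictsToBijection (prepend l) (𝒟 r v 𝐰) (𝒜 r k f (𝐱 ++ 𝐰))) ×
    RestrictsToBijection (prepend l) (Deoᵐᵃˣ k v w 𝐰) (affineDeoᵐᵃˣ k f (𝐱 ++ 𝐰)) ×
    upSteps P ≐ image w k ×
    image w k ≐ I₁ f
corollary3p12 n k k≤n v w v≤w grass 𝐱 𝐰 x-reduced w-reduced =
  (f-average k w v k≤n , f-bounded k w grass v v≤w) ,
  τₚ-reduced k w grass 𝐱 𝐰 x-reduced w-reduced k≤n ,
  bijection ,
  bijection (n ℕ.∸ cycles (f[ v , w ] k)) ,
  upSteps≐image k w k≤n ,
  image≐I₁ k w v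
  where
  bijection = prepend-bijection k w grass 𝐱 𝐰 x-reduced w-reduced v
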